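{- For all integers $n\ge 1$, \[ b(2n,n-1)=p(2n,n-1)=\frac12\sum_{\substack{k\ge1\\ k\text{ odd}}}\binom{2n}{k}EC\left(\frac{k-1}{2}\right)EC\left(\frac{2n-k-1}{2}\right), \] where the sum is over odd $k$ with $1\le k\le 2n-1$.
   Context: For a permutation $\pi=\pi_1\cdots\pi_m\in S_m$, a position $i\in\{1,\dots,m-1\}$ is an ascent if $\pi_i<\pi_{i+1}$ and a descent if $\pi_i>\pi_{i+1}$. The permutation $\pi$ is called ballot if for every $1\le k\le m-1$, the number of ascents among positions $1,\dots,k$ is at least the number of descents among positions $1,\dots,k$. Let $b(m,d)$ be the number of ballot permutations in $S_m$ with exactly $d$ descents. For a cycle $\mathfrak c=(c_1,\dots,c_k)$ of a permutation (fixed points are cycles of length 1), let $\mathrm{cA}(\mathfrak c)$ be the number of $i\in\{1,\dots,k\}$ with $c_i\le c_{i+1}$ and $\mathrm{cD}(\mathfrak c)$ the number with $c_i>c_{i+1}$, where $c_{k+1}=c_1$; let $M(\mathfrak c)=\min(\mathrm{cA}(\mathfrak c),\mathrm{cD}(\mathfrak c))$, and for a permutation $\pi$ let $M(\pi)$ be the sum of $M$ over its cycles. Let $p(m,d)$ be the number of permutations in $S_m$ all of whose cycles have odd length and with $M(\pi)=d$. $E(m,d)$ is the number of permutations of $[m]$ with exactly $d$ descents. The Eulerian–Catalan numbers are $EC(n)=2E(2n,n-1)$ for $n\ge1$, and $EC(0)=1$. -}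

module Defs where

open import Data.Nat using (ℕ; zero; suc; _+_; _*_; _∸_; _≤ᵇ_; _<ᵇ_; _≡ᵇ_)
open import Data.Nat.Combinatorics using (_C_)
open import Data.Bool using (Bool; true; false; _∧_; if_then_else_; not)
open import Data.Product using (_×_; _,_)
open import Data.List using (List; []; _∷_; _++_; map; concatMap; filterᵇ; length; upTo; zip; take)
open import Data.Nat.ListAction using (sum)
open import Data.List.Relation.Unary.Unique.DecPropositional (Data.Nat._≟_) using (unique?)
open import Relation.Nullary.Decidable using (does)

range1 : ℕ → List ℕ
range1 m = map suc (upTo m)

words : ℕ → ℕ → List (List ℕ)
words m zero    = [] ∷ []
words m (suc l) = concatMap (λ x → map (x ∷_) (words m l)) (range1 m)

-- S_m: permutations of [m] in one-line notation π₁ ⋯ πₘ, i.e. the words of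
-- length m over {1..m} without repeated letters (each listed exactly once)
perms : ℕ → List (List ℕ)
perms m = filterᵇ (λ w → does (unique? w)) (words m m)

adjPairs : List ℕ → List (ℕ × ℕ)
adjPairs [] = []
adjPairs (x ∷ xs) = zip (x ∷ xs) xs

isAsc : ℕ × ℕ → Bool
isAsc (a , b) = a <ᵇ b

isDes : ℕ × ℕ → Bool
isDes (a , b) = b <ᵇ a

allᵇ : {A : Set} → (A → Bool) → List A → Bool
allᵇ q [] = true
allᵇ q (x ∷ xs) = q x ∧ allᵇ q xs

countᵇ : {A : Set} → (A → Bool) → List A → ℕ
countᵇ p xs = length (filterᵇ p xs)

des : List ℕ → ℕ
des w = countᵇ isDes (adjPairs w)

ballot : List ℕ → Bool
ballot w = allᵇ (λ k → countᵇ isDes (take k (adjPairs w)) ≤ᵇ countᵇ isAsc (take k (adjPairs w)))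
               (range1 (length w ∸ 1))

b : ℕ → ℕ → ℕ
b m d = countᵇ (λ w → ballot w ∧ (des w ≡ᵇ d)) (perms m)

E : ℕ → ℕ → ℕ
E m d = countᵇ (λ w → des w ≡ᵇ d) (perms m)

EC : ℕ → ℕ
EC zero    = 1
EC (suc n) = 2 * E (2 * suc n) n

-- π(j) = π_j for the one-line word w (j ∈ 1..m)
app : List ℕ → ℕ → ℕ
app [] j = 0
app (x ∷ xs) zero = 0
app (x ∷ xs) (suc zero) = x
app (x ∷ xs) (suc (suc j)) = app xs (suc j)

orbitFrom : List ℕ → ℕ → ℕ → ℕ → List ℕ
orbitFrom w i zero c = []
orbitFrom w i (suc f) c =
  c ∷ (if app w c ≡ᵇ i then [] else orbitFrom w i f (app w c))

-- the cycle (i, π(i), π²(i), …) containing i (at most m elements)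
orbit : List ℕ → ℕ → List ℕ
orbit w i = orbitFrom w i (length w) i

-- the cycles of π, each listed once (starting from its minimal element);
-- fixed points are cycles of length 1
cycles : List ℕ → List (List ℕ)
cycles w = map (orbit w) (filterᵇ (λ i → allᵇ (i ≤ᵇ_) (orbit w i)) (range1 (length w)))

cycPairs : List ℕ → List (ℕ × ℕ)
cycPairs [] = []
cycPairs (x ∷ xs) = zip (x ∷ xs) (xs ++ (x ∷ []))

cA : List ℕ → ℕ
cA c = countᵇ (λ { (a , b) → a ≤ᵇ b }) (cycPairs c)

cD : List ℕ → ℕ
cD c = countᵇ (λ { (a , b) → b <ᵇ a }) (cycPairs c)

minℕ : ℕ → ℕ → ℕ
minℕ = Data.Nat._⊓_

Mcyc : List ℕ → ℕ
Mcyc c = minℕ (cA c) (cD c)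

Mperm : List ℕ → ℕ
Mperm w = sum (map Mcyc (cycles w))

isOdd : ℕ → Bool
isOdd zero = false
isOdd (suc n) = not (isOdd n)

p : ℕ → ℕ → ℕ
p m d = countᵇ (λ w → allᵇ (λ c → isOdd (length c)) (cycles w) ∧ (Mperm w ≡ᵇ d)) (perms m)

-- Σ_{k odd, 1 ≤ k ≤ 2n-1} C(2n,k) EC((k-1)/2) EC((2n-k-1)/2), with k = 2j+1, j = 0..n-1
ECsum : ℕ → ℕ
ECsum n = sum (map (λ j → ((2 * n) C (2 * j + 1)) * EC j * EC (n ∸ 1 ∸ j)) (upTo n))

{-# OPTIONS --safe #-}

-- A ballot permutation of length 2n with n − 1 descents is a lattice path from height 0 to height 1
-- staying nonnegative; cutting it at the last up-step leaving 0 yields two excursions joined by an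
-- ascent.  Reversing a word turns excursions into excursions and the joining ascent into a descent,
-- so twice the number of such permutations counts all pairs of excursions with total letter set [2n].
-- On the other side, an odd cycle of length k has M ≤ (k − 1)/2, so M(π) = n − 1 forces exactly two
-- cycles, both with cyclic ascents and descents as balanced as possible; twice p counts ordered pairs
-- of such cycles.  By the cycle lemma every balanced cycle has exactly one rotation that is an
-- excursion, and writing a cycle from its minimum shows that there are EC(j) of them on 2j + 1 letters.
module Submission where

open import Defs
open import Data.Nat
open import Data.Nat.Properties
open import Data.List.Membership.Propositional.Properties
import Data.List.Relation.Unary.Unique.Propositional.Properties as Uniq
import Data.List.Relation.Unary.All.Properties as Allₚ
open import Relation.Binary.PropositionalEquality
import Data.List.Relation.Binary.Permutation.Setoid.Properties as Permₛ
import Data.List.Relation.Unary.AllPairs.Properties as AllPairsₚ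
open import Data.Bool using (Bool; true; false; T; not; _∧_; if_then_else_)
open import Data.Bool.Properties using (T?; not-involutive; T-∧)
open import Data.Product using (∃; _×_; _,_; proj₁; proj₂; ∃₂)
open import Data.Sum as Sum using (_⊎_; inj₁; inj₂; [_,_]′)
open import Data.Empty using (⊥; ⊥-elim)
open import Data.List using (List; []; _∷_; _++_; map; concat; concatMap; filterᵇ; length; upTo; cartesianProduct; applyUpTo; reverse; take; zip)
open import Data.List.Properties using (length-map; length-++; length-upTo; length-removeAt′; ∷-injectiveˡ; ∷-injectiveʳ; ++-assoc; ++-identityʳ; unfold-reverse; reverse-involutive; reverse-++; ∷ʳ-injectiveˡ; map-injective; take-map; map-++; map-cong-local; length-applyUpTo)
open import Data.Nat.ListAction using (sum)
open import Data.List.Membership.Propositional using (_∈_; _∉_; find; _─_)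
open import Data.List.Membership.DecPropositional Data.Nat._≟_ using (_∈?_)
open import Data.List.Relation.Unary.Any as Any using (Any; here; there)
open import Data.List.Relation.Unary.All as All using (All; []; _∷_)
open import Data.List.Relation.Unary.AllPairs using (AllPairs; []; _∷_)
open import Data.List.Relation.Unary.Unique.Propositional using (Unique)
open import Data.List.Relation.Unary.Unique.DecPropositional Data.Nat._≟_ using (unique?)
open import Relation.Nullary using (¬_; yes; no; does; contradiction)
open import Function using (_∘_; id)
open import Data.Nat.Tactic.RingSolver using (solve-∀)
open import Data.List.Relation.Binary.Permutation.Propositional using (_↭_; ↭-sym; ↭⇒↭ₛ)
open import Data.List.Relation.Binary.Permutation.Propositional.Properties using (All-resp-↭; ↭-length; ++-comm; ↭-reverse; ++⁺)
open import Data.Nat.Combinatorics using (_C_; nCk+nC[k+1]≡[n+1]C[k+1]; k>n⇒nCk≡0)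
open import Relation.Binary.Definitions using (tri<; tri≈; tri>)
open import Function.Bundles using (Equivalence)
open import Data.List.Relation.Binary.Disjoint.Propositional using (Disjoint)

-- No bijection between the two kinds of permutations is built. Twice each number counts ordered
-- pairs of words whose concatenation is a permutation of [2n], and one count of pairs serves both
-- sides. It asks only that the property of the words depend on the relative order of the letters:
-- the letters of the first word are chosen, giving the binomial coefficient, and both words are
-- standardised, giving a product of two one-word counts.
--
-- The factor 2 in EC(j) = 2E(2j, j - 1) arises when a balanced cycle on 2j + 1 letters is written
-- from its minimum. Deleting the minimum removes one cyclic ascent and one cyclic descent, so the
-- remaining 2j letters have 2j - 1 steps with j - 1 or j descents; reversal exchanges the two
-- cases. A fixed point gives EC(0) = 1.
--
-- The factor 1/2 of the formula comes from two equal classes of pairs, told apart by the direction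
-- of the joining step on one side and by the order of the minima on the other. Distinct letters
-- make the classes disjoint.

unique⇒∉ : ∀ {A : Set} {x : A} {xs} → Unique (x ∷ xs) → x ∉ xs
unique⇒∉ (x≢ ∷ _) x∈ = All.lookup x≢ x∈ refl

∉⇒unique : ∀ {A : Set} {x : A} {xs} → x ∉ xs → Unique xs → Unique (x ∷ xs)
∉⇒unique x∉ u = All.tabulate (λ { y∈ refl → x∉ y∈ }) ∷ u

∈-─⁺ : ∀ {A : Set} {x y : A} {xs} (x∈ : x ∈ xs) → y ∈ xs → y ≢ x → y ∈ xs ─ x∈
∈-─⁺ (here refl) (here refl) y≢x = contradiction refl y≢x
∈-─⁺ (here _)    (there y∈)  y≢x = y∈
∈-─⁺ (there x∈)  (here eq)   y≢x = here eq
∈-─⁺ (there x∈)  (there y∈)  y≢x = there (∈-─⁺ x∈ y∈ y≢x)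

length-─ : ∀ {A : Set} {x : A} {xs} (x∈ : x ∈ xs) → length xs ≡ suc (length (xs ─ x∈))
length-─ {xs = xs} x∈ = length-removeAt′ xs (Any.index x∈)

unique-⊆⇒length≤ : ∀ {A : Set} {xs ys : List A} → Unique xs →
                   (∀ {x} → x ∈ xs → x ∈ ys) → length xs ≤ length ys
unique-⊆⇒length≤ {xs = []}     _ _ = z≤n
unique-⊆⇒length≤ {xs = x ∷ xs} {ys} u@(_ ∷ u′) xs⊆ys =
  subst (suc (length xs) ≤_) (sym (length-─ x∈)) (s≤s (unique-⊆⇒length≤ u′ sub))
  where
  x∈ : x ∈ ys
  x∈ = xs⊆ys (here refl)
  sub : ∀ {y} → y ∈ xs → y ∈ ys ─ x∈
  sub y∈ = ∈-─⁺ x∈ (xs⊆ys (there y∈)) λ { refl → unique⇒∉ u y∈ }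

-- Pigeonhole: a missed entry could be put in front of `xs`, giving a repetition-free list inside
-- `ys` that is longer than `ys`.
unique-⊆-full : ∀ {xs ys : List ℕ} → Unique xs → (∀ {x} → x ∈ xs → x ∈ ys) →
                length ys ≤ length xs → ∀ {y} → y ∈ ys → y ∈ xs
unique-⊆-full {xs} u xs⊆ys len {y} y∈ with y ∈? xs
... | yes y∈xs = y∈xs
... | no  y∉xs = contradiction (≤-trans (unique-⊆⇒length≤ (∉⇒unique y∉xs u) sub) len) (<⇒≱ ≤-refl)
  where
  sub : ∀ {z} → z ∈ y ∷ xs → z ∈ _
  sub (here refl) = y∈
  sub (there z∈)  = xs⊆ys z∈

Increasing : List ℕ → Set
Increasing = AllPairs _<_

increasing⇒unique : ∀ {xs} → Increasing xs → Unique xs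
increasing⇒unique []         = []
increasing⇒unique (x< ∷ inc) = All.map <⇒≢ x< ∷ increasing⇒unique inc

-- Makes a sorted list the normal form of a finite set. Letter sets of words and lists of cycle
-- minima are identified in this way.
increasing-≡ : ∀ {xs ys} → Increasing xs → Increasing ys → (∀ {x} → x ∈ xs → x ∈ ys) →
               (∀ {x} → x ∈ ys → x ∈ xs) → xs ≡ ys
increasing-≡ {[]}     {[]}     _ _ _ _ = refl
increasing-≡ {[]}     {y ∷ ys} _ _ _ g with () ← g (here refl)
increasing-≡ {x ∷ xs} {[]}     _ _ f _ with () ← f (here refl)
increasing-≡ {x ∷ xs} {y ∷ ys} (x< ∷ ix) (y< ∷ iy) f g = cong₂ _∷_ x≡y (increasing-≡ ix iy f′ g′)
  where
  ≤-head : ∀ {a b as} → All (a <_) as → b ∈ a ∷ as → a ≤ b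
  ≤-head a< (here refl) = ≤-refl
  ≤-head a< (there b∈)  = <⇒≤ (All.lookup a< b∈)
  x≡y : x ≡ y
  x≡y = ≤-antisym (≤-head x< (g (here refl))) (≤-head y< (f (here refl)))
  f′ : ∀ {z} → z ∈ xs → z ∈ ys
  f′ z∈ with f (there z∈)
  ... | there z∈ys = z∈ys
  ... | here refl  = contradiction x≡y (<⇒≢ (All.lookup x< z∈))
  g′ : ∀ {z} → z ∈ ys → z ∈ xs
  g′ z∈ with g (there z∈)
  ... | there z∈xs = z∈xs
  ... | here refl  = contradiction (sym x≡y) (<⇒≢ (All.lookup y< z∈))

-- Finite cardinalities of predicates

-- Counts the elements `x`, not the proofs of `P x`, so `P x` may carry data or have several proofs.
-- The listing is kept because the numbers to be compared are lengths of filtered lists.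
record Card {A : Set} (P : A → Set) (n : ℕ) : Set where
  constructor mkCard
  field
    elems    : List A
    unique   : Unique elems
    sound    : ∀ {x} → x ∈ elems → P x
    complete : ∀ {x} → P x → x ∈ elems
    size     : length elems ≡ n

open Card

card-unique : ∀ {A : Set} {P : A → Set} {m n} → Card P m → Card P n → m ≡ n
card-unique c d = begin
  _                ≡⟨ size c ⟨
  length (elems c) ≡⟨ ≤-antisym (unique-⊆⇒length≤ (unique c) (complete d ∘ sound c))
                                (unique-⊆⇒length≤ (unique d) (complete c ∘ sound d)) ⟩
  length (elems d) ≡⟨ size d ⟩
  _                ∎
  where open ≡-Reasoning

card-⇔ : ∀ {A : Set} {P Q : A → Set} {n} → (∀ {x} → P x → Q x) → (∀ {x} → Q x → P x) →
         Card P n → Card Q n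
card-⇔ f g (mkCard xs u s c e) = mkCard xs u (f ∘ s) (c ∘ g) e

-- The bijection is a relation, so neither direction needs values outside `P` and `Q`, and a
-- relation such as `Rot` can be used as it stands. The list of images is built along the membership
-- proofs because `total` asks for `P x`.
card-bij : ∀ {A B : Set} {P : A → Set} {Q : B → Set} {n} (R : A → B → Set) →
           (∀ {x} → P x → ∃ λ y → Q y × R x y) →
           (∀ {y} → Q y → ∃ λ x → P x × R x y) →
           (∀ {x y y′} → P x → Q y → Q y′ → R x y → R x y′ → y ≡ y′) →
           (∀ {x x′ y} → P x → P x′ → Q y → R x y → R x′ y → x ≡ x′) →
           Card P n → Card Q n
card-bij {A} {B} {P} {Q} R total onto functional injective (mkCard xs u s c e) =
  mkCard (images xs s) (images-unique xs s u)
    (λ y∈ → let x , x∈ , q , r = images-sound xs s y∈ in q)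
    (λ q → let x , px , r = onto q in images-complete xs s (c px) q r)
    (trans (images-length xs s) e)
  where
  images : (zs : List A) → (∀ {x} → x ∈ zs → P x) → List B
  images []       s = []
  images (x ∷ zs) s = proj₁ (total (s (here refl))) ∷ images zs (s ∘ there)
  images-length : ∀ zs (s : ∀ {x} → x ∈ zs → P x) → length (images zs s) ≡ length zs
  images-length []       s = refl
  images-length (x ∷ zs) s = cong suc (images-length zs (s ∘ there))
  images-sound : ∀ zs (s : ∀ {x} → x ∈ zs → P x) {y} → y ∈ images zs s → ∃ λ x → x ∈ zs × Q y × R x y
  images-sound (x ∷ zs) s (here refl) = x , here refl , proj₂ (total (s (here refl)))
  images-sound (x ∷ zs) s (there y∈) =
    let x′ , x∈ , qr = images-sound zs (s ∘ there) y∈ in x′ , there x∈ , qr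
  images-complete : ∀ zs (s : ∀ {x} → x ∈ zs → P x) {x y} → x ∈ zs → Q y → R x y → y ∈ images zs s
  images-complete (x ∷ zs) s (here refl) q r =
    let _ , q′ , r′ = total (s (here refl)) in here (functional (s (here refl)) q q′ r r′)
  images-complete (x ∷ zs) s (there x∈) q r = there (images-complete zs (s ∘ there) x∈ q r)
  images-unique : ∀ zs (s : ∀ {x} → x ∈ zs → P x) → Unique zs → Unique (images zs s)
  images-unique []       s u = []
  images-unique (x ∷ zs) s u@(_ ∷ u′) = ∉⇒unique notin (images-unique zs (s ∘ there) u′)
    where
    notin : proj₁ (total (s (here refl))) ∉ images zs (s ∘ there)
    notin y∈ with images-sound zs (s ∘ there) y∈
    ... | x′ , x′∈ , q , r =
      unique⇒∉ u (subst (_∈ zs) (injective (s (there x′∈)) (s (here refl)) q r (proj₂ (proj₂ (total (s (here refl)))))) x′∈)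

card-⊎ : ∀ {A : Set} {P Q : A → Set} {m n} → (∀ {x} → P x → Q x → ⊥) →
         Card P m → Card Q n → Card (λ x → P x ⊎ Q x) (m + n)
card-⊎ disjoint (mkCard xs u s c e) (mkCard xs′ u′ s′ c′ e′) =
  mkCard (xs ++ xs′) (Uniq.++⁺ u u′ λ { (x∈ , x∈′) → disjoint (s x∈) (s′ x∈′) })
    ([ inj₁ ∘ s , inj₂ ∘ s′ ]′ ∘ ∈-++⁻ xs)
    [ ∈-++⁺ˡ ∘ c , ∈-++⁺ʳ xs ∘ c′ ]′
    (trans (length-++ xs) (cong₂ _+_ e e′))

length-cartesianProduct : ∀ {A B : Set} (xs : List A) (ys : List B) →
                          length (cartesianProduct xs ys) ≡ length xs * length ys
length-cartesianProduct []       ys = refl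
length-cartesianProduct (x ∷ xs) ys = trans (length-++ (map (x ,_) ys))
  (cong₂ _+_ (length-map (x ,_) ys) (length-cartesianProduct xs ys))

card-× : ∀ {A B : Set} {P : A → Set} {Q : B → Set} {m n} → Card P m → Card Q n →
         Card (λ (x , y) → P x × Q y) (m * n)
card-× (mkCard xs u s c e) (mkCard ys u′ s′ c′ e′) =
  mkCard (cartesianProduct xs ys) (Uniq.cartesianProduct⁺ u u′)
    (λ xy∈ → let x∈ , y∈ = ∈-cartesianProduct⁻ xs ys xy∈ in s x∈ , s′ y∈)
    (λ (p , q) → ∈-cartesianProduct⁺ (c p) (c′ q))
    (trans (length-cartesianProduct xs ys) (cong₂ _*_ e e′))

-- Counts add up because `x` determines its index `i`. The index will be the half-length of the
-- first word of a pair.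
card-∃< : ∀ {A : Set} {P : ℕ → A → Set} {f : ℕ → ℕ} n → (∀ {i j x} → P i x → P j x → i ≡ j) →
          (∀ {i} → i < n → Card (P i) (f i)) →
          Card (λ x → ∃ λ i → i < n × P i x) (sum (map f (upTo n)))
card-∃< {P = P} {f} n functional cards = card-⇔ shrink grow (go (upTo n) (Uniq.upTo⁺ n) ∈-upTo⁻)
  where
  shrink : ∀ {x} → (∃ λ i → i ∈ upTo n × P i x) → ∃ λ i → i < n × P i x
  shrink (i , i∈ , q) = i , ∈-upTo⁻ i∈ , q
  grow : ∀ {x} → (∃ λ i → i < n × P i x) → ∃ λ i → i ∈ upTo n × P i x
  grow (i , i< , q) = i , ∈-upTo⁺ i< , q
  go : ∀ is → Unique is → (∀ {i} → i ∈ is → i < n) → Card (λ x → ∃ λ i → i ∈ is × P i x) (sum (map f is))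
  go []       u i< = mkCard [] [] (λ ()) (λ { (_ , () , _) }) refl
  go (i ∷ is) u@(_ ∷ u′) i< =
    card-⇔ [ (λ q → i , here refl , q) , (λ (j , j∈ , q) → j , there j∈ , q) ]′
           (λ { (_ , here refl , q) → inj₁ q ; (j , there j∈ , q) → inj₂ (j , j∈ , q) })
           (card-⊎ (λ { q (j , j∈ , q′) → unique⇒∉ u (subst (_∈ is) (functional q′ q) j∈) })
                   (cards (i< (here refl))) (go is u′ (i< ∘ there)))

card-filterᵇ : ∀ {A : Set} {P : A → Set} {n} (q : A → Bool) (c : Card P n) →
               Card (λ x → P x × T (q x)) (countᵇ q (elems c))
card-filterᵇ q c = mkCard (filterᵇ q (elems c)) (Uniq.filter⁺ (T? ∘ q) (unique c))
  (λ x∈ → let x∈′ , t = ∈-filter⁻ (T? ∘ q) x∈ in sound c x∈′ , t)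
  (λ (p , t) → ∈-filter⁺ (T? ∘ q) (complete c p) t) refl

-- Permutations as repetition-free words

_∈[1,_] : ℕ → ℕ → Set
x ∈[1, m ] = 1 ≤ x × x ≤ m

range1⁺ : ∀ {m x} → x ∈[1, m ] → x ∈ range1 m
range1⁺ {x = suc x} (_ , x≤) = ∈-map⁺ suc (∈-upTo⁺ x≤)

range1⁻ : ∀ {m x} → x ∈ range1 m → x ∈[1, m ]
range1⁻ x∈ with ∈-map⁻ suc x∈
... | y , y∈ , refl = s≤s z≤n , ∈-upTo⁻ y∈

length-range1 : ∀ m → length (range1 m) ≡ m
length-range1 m = trans (length-map suc (upTo m)) (length-upTo m)

unique-range1 : ∀ m → Unique (range1 m)
unique-range1 m = Uniq.map⁺ suc-injective (Uniq.upTo⁺ m)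

record IsPerm (m : ℕ) (w : List ℕ) : Set where
  constructor isPerm
  field
    len      : length w ≡ m
    distinct : Unique w
    bounds   : All (_∈[1, m ]) w

open IsPerm

perm-full : ∀ {m w x} → IsPerm m w → x ∈[1, m ] → x ∈ w
perm-full {m} (isPerm l u bs) x∈ =
  unique-⊆-full u (range1⁺ ∘ All.lookup bs) (≤-reflexive (trans (length-range1 m) (sym l))) (range1⁺ x∈)

words⁺ : ∀ {m} l {w} → length w ≡ l → All (_∈[1, m ]) w → w ∈ words m l
words⁺ zero    {[]}    refl [] = here refl
words⁺ {m} (suc l) {x ∷ w} eq (b ∷ bs) =
  ∈-concatMap⁺ (λ x → map (x ∷_) (words m l)) {xs = range1 m}
    (Any.map (λ { refl → ∈-map⁺ (x ∷_) (words⁺ l (suc-injective eq) bs) }) (range1⁺ b))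

words⁻ : ∀ {m} l {w} → w ∈ words m l → length w ≡ l × All (_∈[1, m ]) w
words⁻ zero (here refl) = refl , []
words⁻ {m} (suc l) w∈ with find (∈-concatMap⁻ (λ x → map (x ∷_) (words m l)) {xs = range1 m} w∈)
... | x , x∈ , w∈′ with ∈-map⁻ (x ∷_) w∈′
... | v , v∈ , refl = let e , bs = words⁻ l v∈ in cong suc e , range1⁻ x∈ ∷ bs

unique-words : ∀ m l → Unique (words m l)
unique-words m zero    = [] ∷ []
unique-words m (suc l) = go (range1 m) (unique-range1 m)
  where
  go : ∀ xs → Unique xs → Unique (concatMap (λ x → map (x ∷_) (words m l)) xs)
  go []       u = []
  go (x ∷ xs) u@(_ ∷ u′) = Uniq.++⁺ (Uniq.map⁺ ∷-injectiveʳ (unique-words m l)) (go xs u′) disjoint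
    where
    disjoint : ∀ {w} → ¬ (w ∈ map (x ∷_) (words m l) × w ∈ concatMap (λ x → map (x ∷_) (words m l)) xs)
    disjoint (w∈ , w∈′) with ∈-map⁻ (x ∷_) w∈ | find (∈-concatMap⁻ (λ x → map (x ∷_) (words m l)) {xs = xs} w∈′)
    ... | v , v∈ , refl | y , y∈ , w∈″ with ∈-map⁻ (y ∷_) w∈″
    ... | v′ , _ , refl = unique⇒∉ u y∈

card-perms : ∀ m → Card (IsPerm m) (length (perms m))
card-perms m = mkCard (perms m) (Uniq.filter⁺ (T? ∘ (does ∘ unique?)) (unique-words m m)) snd cmp refl
  where
  snd : ∀ {w} → w ∈ perms m → IsPerm m w
  snd {w} w∈ with ∈-filter⁻ (T? ∘ (does ∘ unique?)) {xs = words m m} w∈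
  ... | w∈′ , t with unique? w | words⁻ m w∈′
  ... | yes u | l , bs = isPerm l u bs
  cmp : ∀ {w} → IsPerm m w → w ∈ perms m
  cmp {w} (isPerm l u bs) = ∈-filter⁺ (T? ∘ (does ∘ unique?)) (words⁺ m l bs) t
    where
    t : T (does (unique? w))
    t with unique? w
    ... | yes _ = _
    ... | no ¬u = ¬u u

card-perms-countᵇ : ∀ m (q : List ℕ → Bool) → Card (λ w → IsPerm m w × T (q w)) (countᵇ q (perms m))
card-perms-countᵇ m q = card-filterᵇ q (card-perms m)

-- Step sequences

≤ᵇ-flip : ∀ {x y} → x ≢ y → (y ≤ᵇ x) ≡ not (x ≤ᵇ y)
≤ᵇ-flip {x} {y} x≢y with x ≤ᵇ y in e₁ | y ≤ᵇ x in e₂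
... | true  | false = refl
... | false | true  = refl
... | true  | true  = contradiction (≤-antisym (≤ᵇ⇒≤ x y (subst T (sym e₁) _)) (≤ᵇ⇒≤ y x (subst T (sym e₂) _))) x≢y
... | false | false with ≤-total x y
...   | inj₁ x≤y = ⊥-elim (subst T e₁ (≤⇒≤ᵇ x≤y))
...   | inj₂ y≤x = ⊥-elim (subst T e₂ (≤⇒≤ᵇ y≤x))

ups downs : List Bool → ℕ
ups []            = 0
ups (true  ∷ s)   = suc (ups s)
ups (false ∷ s)   = ups s
downs []          = 0
downs (true  ∷ s) = downs s
downs (false ∷ s) = suc (downs s)

ups-++ : ∀ s t → ups (s ++ t) ≡ ups s + ups t
ups-++ []          t = refl
ups-++ (true  ∷ s) t = cong suc (ups-++ s t)
ups-++ (false ∷ s) t = ups-++ s t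

downs-++ : ∀ s t → downs (s ++ t) ≡ downs s + downs t
downs-++ []          t = refl
downs-++ (true  ∷ s) t = downs-++ s t
downs-++ (false ∷ s) t = cong suc (downs-++ s t)

ups+downs : ∀ s → ups s + downs s ≡ length s
ups+downs []          = refl
ups+downs (true  ∷ s) = cong suc (ups+downs s)
ups+downs (false ∷ s) = trans (+-suc (ups s) (downs s)) (cong suc (ups+downs s))

-- The step sequence of a reversed word: steps come in the opposite order and each is traversed in
-- the opposite direction.
flipReverse : List Bool → List Bool
flipReverse []      = []
flipReverse (x ∷ s) = flipReverse s ++ not x ∷ []

downs-flipReverse : ∀ s → downs (flipReverse s) ≡ ups s
downs-flipReverse []          = refl
downs-flipReverse (true  ∷ s) = trans (downs-++ (flipReverse s) _) (trans (+-comm _ 1) (cong suc (downs-flipReverse s)))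
downs-flipReverse (false ∷ s) = trans (downs-++ (flipReverse s) _) (trans (+-identityʳ _) (downs-flipReverse s))

-- Lattice paths and the cycle lemma

-- Heights are natural numbers and `down` only leaves a successor, so nonnegativity is built into
-- the type.
data Path : ℕ → List Bool → ℕ → Set where
  stop : ∀ {h} → Path h [] h
  up   : ∀ {h s k} → Path (suc h) s k → Path h (true ∷ s) k
  down : ∀ {h s k} → Path h s k → Path (suc h) (false ∷ s) k

path-++ : ∀ {h s k t l} → Path h s k → Path k t l → Path h (s ++ t) l
path-++ stop     π = π
path-++ (up ρ)   π = up (path-++ ρ π)
path-++ (down ρ) π = down (path-++ ρ π)

path-lift : ∀ {h s k} → Path h s k → Path (suc h) s (suc k)
path-lift stop     = stop
path-lift (up π)   = up (path-lift π)
path-lift (down π) = down (path-lift π)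

path-split : ∀ {h t l} s → Path h (s ++ t) l → ∃ λ k → Path h s k × Path k t l
path-split []          π        = _ , stop , π
path-split (true  ∷ s) (up π)   = let k , ρ , σ = path-split s π in k , up ρ , σ
path-split (false ∷ s) (down π) = let k , ρ , σ = path-split s π in k , down ρ , σ

path-sum : ∀ {h s k} → Path h s k → h + ups s ≡ k + downs s
path-sum stop = refl
path-sum {h} {true ∷ s} (up π) = trans (+-suc h (ups s)) (path-sum π)
path-sum {suc h} {false ∷ s} {k} (down π) = trans (cong suc (path-sum π)) (sym (+-suc k (downs s)))

path-flipReverse : ∀ {h s k} → Path h s k → Path k (flipReverse s) h
path-flipReverse stop     = stop
path-flipReverse (up π)   = path-++ (path-flipReverse π) (down stop)
path-flipReverse (down π) = path-++ (path-flipReverse π) (up stop)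

-- The path is scanned from its end. While the tail stays at height at least 1 it is kept lowered by
-- one (first alternative); once the cut is found it is only carried along.
lastUp : ∀ {h s} → Path h s 1 →
         (∃ λ h′ → h ≡ suc h′ × Path h′ s 0) ⊎
         (∃₂ λ s₁ s₂ → s ≡ s₁ ++ true ∷ s₂ × Path h s₁ 0 × Path 0 s₂ 0)
lastUp stop = inj₁ (0 , refl , stop)
lastUp (up {s = s} π) with lastUp π
-- This step starts at height 0 and the tail never returns there, so the cut is here.
... | inj₁ (zero  , refl , ρ) = inj₂ ([] , s , refl , stop , ρ)
... | inj₁ (suc h , refl , ρ) = inj₁ (h , refl , up ρ)
... | inj₂ (s₁ , s₂ , refl , ρ , σ) = inj₂ (true ∷ s₁ , s₂ , refl , up ρ , σ)
lastUp (down {h} π) with lastUp π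
... | inj₁ (h′ , refl , ρ) = inj₁ (_ , refl , down ρ)
... | inj₂ (s₁ , s₂ , refl , ρ , σ) = inj₂ (false ∷ s₁ , s₂ , refl , down ρ , σ)

lastUp₀ : ∀ {s} → Path 0 s 1 → ∃₂ λ s₁ s₂ → s ≡ s₁ ++ true ∷ s₂ × Path 0 s₁ 0 × Path 0 s₂ 0
lastUp₀ π with lastUp π
... | inj₂ r = r

-- Cuts at the first arrival at 0. Up to that step the path stays at height at least 1, so this part
-- is still a path when lowered by one.
firstDown : ∀ {l s} → Path (suc l) s 0 → ∃₂ λ s₁ s₂ → s ≡ s₁ ++ false ∷ s₂ × Path l s₁ 0 × Path 0 s₂ 0
firstDown (up π) with firstDown π
... | s₁ , s₂ , refl , ρ , σ = true ∷ s₁ , s₂ , refl , up ρ , σ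
firstDown {zero}  (down {s = s} π) = [] , s , refl , stop , π
firstDown {suc l} (down π) with firstDown π
... | s₁ , s₂ , refl , ρ , σ = false ∷ s₁ , s₂ , refl , down ρ , σ

-- Any step sequence is cut at a lowest point: `m` and `l` are the heights of its start and its end
-- above that point.
minimumSplit : ∀ s → ∃₂ λ s₁ s₂ → ∃₂ λ m l → s ≡ s₁ ++ s₂ × Path m s₁ 0 × Path 0 s₂ l
minimumSplit [] = [] , [] , 0 , 0 , refl , stop , stop
minimumSplit (x ∷ s) with minimumSplit s
minimumSplit (false ∷ s) | s₁ , s₂ , m     , l , refl , π , ρ = false ∷ s₁ , s₂ , suc m , l , refl , down π , ρ
minimumSplit (true ∷ s)  | s₁ , s₂ , suc m , l , refl , π , ρ = true ∷ s₁ , s₂ , m , l , refl , up π , ρ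
-- The tail never goes below its own start, and the new start lies one lower: the minimum moves to
-- the front.
minimumSplit (true ∷ s)  | s₁ , s₂ , zero  , l , refl , π , ρ =
  [] , true ∷ s₁ ++ s₂ , 0 , suc l , refl , stop , up (path-++ (path-lift π) (path-lift ρ))

AlmostBalanced : List Bool → Set
AlmostBalanced s = ups s ≡ suc (downs s) ⊎ downs s ≡ suc (ups s)

-- Levi's lemma: of two cuts of one word, one lies at or before the other, and `es` is the piece
-- between them.
++-cases : ∀ {A : Set} (as cs : List A) {bs ds} → as ++ bs ≡ cs ++ ds →
           (∃ λ es → cs ≡ as ++ es × bs ≡ es ++ ds) ⊎ (∃ λ es → as ≡ cs ++ es × ds ≡ es ++ bs)
++-cases []       cs       eq = inj₁ (cs , refl , eq)
++-cases (a ∷ as) []       eq = inj₂ (a ∷ as , refl , sym eq)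
++-cases (a ∷ as) (c ∷ cs) eq with refl ← ∷-injectiveˡ eq with ++-cases as cs (∷-injectiveʳ eq)
... | inj₁ (es , refl , e) = inj₁ (es , refl , e)
... | inj₂ (es , refl , e) = inj₂ (es , refl , e)

data Rot {A : Set} : List A → List A → Set where
  rot : ∀ as bs → Rot (as ++ bs) (bs ++ as)

rot-≡ : ∀ {A : Set} {xs ys : List A} as bs → xs ≡ as ++ bs → ys ≡ bs ++ as → Rot xs ys
rot-≡ as bs refl refl = rot as bs

rot-refl : ∀ {A : Set} {xs : List A} → Rot xs xs
rot-refl {xs = xs} = rot-≡ [] xs refl (sym (++-identityʳ xs))

rot-sym : ∀ {A : Set} {xs ys : List A} → Rot xs ys → Rot ys xs
rot-sym (rot as bs) = rot bs as

-- The two cuts of the common word are compared by Levi's lemma. The equation in `go` avoids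
-- matching two rotations at once, which would have to unify two concatenations.
rot-join : ∀ {A : Set} {xs ys zs : List A} → Rot xs ys → Rot xs zs → Rot ys zs
rot-join r (rot as bs) = go r refl
  where
  go : ∀ {xs ys} → Rot xs ys → xs ≡ as ++ bs → Rot ys (bs ++ as)
  go (rot cs ds) eq with ++-cases cs as eq
  ... | inj₁ (es , refl , refl) = rot-≡ es (bs ++ cs) (++-assoc es bs cs) (sym (++-assoc bs cs es))
  ... | inj₂ (es , refl , refl) = rot-≡ (ds ++ as) es (sym (++-assoc ds as es)) (++-assoc es ds as)

rot-trans : ∀ {A : Set} {xs ys zs : List A} → Rot xs ys → Rot ys zs → Rot xs zs
rot-trans = rot-join ∘ rot-sym

-- Cut at a minimum; the piece after the last up-step (or the first down-step) then completes
-- the other piece to an excursion.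
cycleLemma : ∀ s → AlmostBalanced s → ∃₂ λ t x → Rot s (t ++ x ∷ []) × Path 0 t 0
cycleLemma s bal with minimumSplit s
... | s₁ , s₂ , m , l , refl , π , ρ = [ rising , falling ]′ bal
  where
  u = ups (s₁ ++ s₂)
  d = downs (s₁ ++ s₂)
  regroup : ∀ m a e c → m + (a + (e + c)) ≡ e + (m + a + c)
  regroup = solve-∀
  balance : m + u ≡ l + d
  balance = begin
    m + u                            ≡⟨ cong (m +_) (ups-++ s₁ s₂) ⟩
    m + (ups s₁ + ups s₂)            ≡⟨ cong (λ z → m + (ups s₁ + z)) (path-sum ρ) ⟩
    m + (ups s₁ + (l + downs s₂))    ≡⟨ regroup m (ups s₁) l (downs s₂) ⟩
    l + (m + ups s₁ + downs s₂)      ≡⟨ cong (λ z → l + (z + downs s₂)) (path-sum π) ⟩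
    l + (downs s₁ + downs s₂)        ≡⟨ cong (l +_) (downs-++ s₁ s₂) ⟨
    l + d                            ∎
    where open ≡-Reasoning
  Goal = ∃₂ λ t x → Rot (s₁ ++ s₂) (t ++ x ∷ []) × Path 0 t 0
  rising : u ≡ suc d → Goal
  -- The end is one higher above the minimum than the start, so `s₂` followed by `s₁` lifted by one
  -- runs from 0 to 1 and has a last up-step leaving 0.
  rising eq with refl ← +-cancelʳ-≡ d l (suc m) (trans (sym balance) (trans (cong (m +_) eq) (+-suc m d)))
            with lastUp₀ (path-++ ρ (path-lift π))
  ... | t₁ , t₂ , eq′ , σ , τ = t₂ ++ t₁ , true ,
    rot-trans (rot s₁ s₂) (rot-≡ (t₁ ++ true ∷ []) t₂ (trans eq′ (sym (++-assoc t₁ _ t₂))) (++-assoc t₂ t₁ _)) ,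
    path-++ τ σ
  falling : d ≡ suc u → Goal
  -- The start is one higher than the end, so `s₁` falls from `suc l` to 0. The part `t₁` before its
  -- first arrival at 0, lowered by one, falls from `l` to 0 and can follow `s₂`.
  falling eq with refl ← +-cancelʳ-≡ u m (suc l) (trans balance (trans (cong (l +_) eq) (+-suc l u)))
             with firstDown π
  ... | t₁ , t₂ , refl , σ , τ = (t₂ ++ s₂) ++ t₁ , false ,
    rot-≡ (t₁ ++ false ∷ []) (t₂ ++ s₂)
      (trans (++-assoc t₁ _ s₂) (sym (++-assoc t₁ (false ∷ []) (t₂ ++ s₂)))) (++-assoc (t₂ ++ s₂) t₁ _) ,
    path-++ (path-++ τ ρ) σ

-- Ascents and descents of words

-- The weak comparison is an ascent for distinct letters, and it makes the only cyclic step of a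
-- fixed point an ascent, in accordance with `cA`.
stepsFrom : ℕ → List ℕ → List Bool
stepsFrom x []       = []
stepsFrom x (y ∷ ys) = (x ≤ᵇ y) ∷ stepsFrom y ys

steps : List ℕ → List Bool
steps []       = []
steps (x ∷ xs) = stepsFrom x xs

cyclicSteps : List ℕ → List Bool
cyclicSteps []       = []
cyclicSteps (x ∷ xs) = stepsFrom x (xs ++ x ∷ [])

first last : List ℕ → ℕ
first []          = 0
first (x ∷ xs)    = x
last []           = 0
last (x ∷ [])     = x
last (x ∷ y ∷ xs) = last (y ∷ xs)

last-∷ʳ : ∀ xs x → last (xs ++ x ∷ []) ≡ x
last-∷ʳ []           x = refl
last-∷ʳ (y ∷ [])     x = refl
last-∷ʳ (y ∷ z ∷ xs) x = last-∷ʳ (z ∷ xs) x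

last-reverse : ∀ w → last (reverse w) ≡ first w
last-reverse []       = refl
last-reverse (x ∷ xs) = trans (cong last (unfold-reverse x xs)) (last-∷ʳ (reverse xs) x)

first-reverse : ∀ w → first (reverse w) ≡ last w
first-reverse w = trans (sym (last-reverse (reverse w))) (cong last (reverse-involutive w))

last∈ : ∀ x xs → last (x ∷ xs) ∈ x ∷ xs
last∈ x []       = here refl
last∈ x (y ∷ xs) = there (last∈ y xs)

length-stepsFrom : ∀ x xs → length (stepsFrom x xs) ≡ length xs
length-stepsFrom x []       = refl
length-stepsFrom x (y ∷ ys) = cong suc (length-stepsFrom y ys)

stepsFrom-++ : ∀ x xs y ys → stepsFrom x (xs ++ y ∷ ys) ≡ stepsFrom x (xs ++ y ∷ []) ++ stepsFrom y ys
stepsFrom-++ x []       y ys = refl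
stepsFrom-++ x (z ∷ xs) y ys = cong ((x ≤ᵇ z) ∷_) (stepsFrom-++ z xs y ys)

stepsFrom-∷ʳ : ∀ x xs y → stepsFrom x (xs ++ y ∷ []) ≡ stepsFrom x xs ++ (last (x ∷ xs) ≤ᵇ y) ∷ []
stepsFrom-∷ʳ x []       y = refl
stepsFrom-∷ʳ x (z ∷ xs) y = cong ((x ≤ᵇ z) ∷_) (stepsFrom-∷ʳ z xs y)

steps-++ : ∀ x xs y ys → steps ((x ∷ xs) ++ y ∷ ys) ≡ steps (x ∷ xs) ++ (last (x ∷ xs) ≤ᵇ y) ∷ steps (y ∷ ys)
steps-++ x []       y ys = refl
steps-++ x (z ∷ xs) y ys = cong ((x ≤ᵇ z) ∷_) (steps-++ z xs y ys)

cyclicSteps-∷ : ∀ x xs → cyclicSteps (x ∷ xs) ≡ steps (x ∷ xs) ++ (last (x ∷ xs) ≤ᵇ x) ∷ []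
cyclicSteps-∷ x xs = stepsFrom-∷ʳ x xs x

length-cyclicSteps : ∀ w → length (cyclicSteps w) ≡ length w
length-cyclicSteps []       = refl
length-cyclicSteps (x ∷ xs) = trans (length-stepsFrom x (xs ++ x ∷ [])) (trans (length-++ xs) (+-comm (length xs) 1))

-- A cut between two steps is a cut at a letter: `b` ends the first block of steps and starts the
-- second. Both blocks are nonempty, so `b` lies in `xs` and is not the closing `z`.
stepsFrom-cut : ∀ x xs z e s₁ e′ s₂ → stepsFrom x (xs ++ z ∷ []) ≡ (e ∷ s₁) ++ e′ ∷ s₂ →
  ∃₂ λ as b → ∃ λ bs → xs ≡ as ++ b ∷ bs × stepsFrom x (as ++ b ∷ []) ≡ e ∷ s₁ × stepsFrom b (bs ++ z ∷ []) ≡ e′ ∷ s₂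
stepsFrom-cut x []       z e []         e′ s₂ ()
stepsFrom-cut x []       z e (_ ∷ _)    e′ s₂ ()
stepsFrom-cut x (y ∷ xs) z e []         e′ s₂ eq =
  [] , y , xs , refl , cong (_∷ []) (∷-injectiveˡ eq) , ∷-injectiveʳ eq
stepsFrom-cut x (y ∷ xs) z e (e₁ ∷ s₁)  e′ s₂ eq with stepsFrom-cut y xs z e₁ s₁ e′ s₂ (∷-injectiveʳ eq)
... | as , b , bs , refl , eq₁ , eq₂ = y ∷ as , b , bs , refl , cong₂ _∷_ (∷-injectiveˡ eq) eq₁ , eq₂

cyclicSteps-rot : ∀ a as b bs →
  cyclicSteps ((a ∷ as) ++ b ∷ bs) ≡ stepsFrom a (as ++ b ∷ []) ++ stepsFrom b (bs ++ a ∷ [])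
cyclicSteps-rot a as b bs = trans (cong (stepsFrom a) (++-assoc as (b ∷ bs) (a ∷ []))) (stepsFrom-++ a as b (bs ++ a ∷ []))

-- Carries the cycle lemma, which speaks of steps, over to words.
cyclicSteps-rot⁻ : ∀ {w s} → Rot (cyclicSteps w) s → ∃ λ w′ → Rot w w′ × cyclicSteps w′ ≡ s
cyclicSteps-rot⁻ {w} r = go r refl
  where
  go : ∀ {t s} → Rot t s → cyclicSteps w ≡ t → ∃ λ w′ → Rot w w′ × cyclicSteps w′ ≡ s
  go (rot [] s₂) eq = w , rot-refl , trans eq (sym (++-identityʳ s₂))
  go (rot (e ∷ s₁) []) eq = w , rot-refl , trans eq (++-identityʳ (e ∷ s₁))
  go (rot (e ∷ s₁) (e′ ∷ s₂)) eq = cut w eq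
    where
    cut : ∀ w → cyclicSteps w ≡ (e ∷ s₁) ++ e′ ∷ s₂ → ∃ λ w′ → Rot w w′ × cyclicSteps w′ ≡ (e′ ∷ s₂) ++ e ∷ s₁
    cut (x ∷ xs) eq with stepsFrom-cut x xs x e s₁ e′ s₂ eq
    ... | as , b , bs , refl , eq₁ , eq₂ =
      (b ∷ bs) ++ x ∷ as , rot (x ∷ as) (b ∷ bs) , trans (cyclicSteps-rot b bs x as) (cong₂ _++_ eq₂ eq₁)

almostBalanced-rot : ∀ {s t} → Rot s t → AlmostBalanced s → AlmostBalanced t
almostBalanced-rot (rot as bs) = [ (λ e → inj₁ (trans (uu bs as) (trans e (cong suc (dd as bs))))) ,
                                   (λ e → inj₂ (trans (dd bs as) (trans e (cong suc (uu as bs))))) ]′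
  where
  uu : ∀ as bs → ups (as ++ bs) ≡ ups (bs ++ as)
  uu as bs = trans (ups-++ as bs) (trans (+-comm (ups as) _) (sym (ups-++ bs as)))
  dd : ∀ as bs → downs (as ++ bs) ≡ downs (bs ++ as)
  dd as bs = trans (downs-++ as bs) (trans (+-comm (downs as) _) (sym (downs-++ bs as)))

rot-cyclicSteps : ∀ {w w′} → Rot w w′ → Rot (cyclicSteps w) (cyclicSteps w′)
rot-cyclicSteps (rot [] bs) = subst (λ z → Rot (cyclicSteps bs) (cyclicSteps z)) (sym (++-identityʳ bs)) rot-refl
rot-cyclicSteps (rot as@(_ ∷ _) []) = subst (λ z → Rot (cyclicSteps z) (cyclicSteps as)) (sym (++-identityʳ as)) rot-refl
rot-cyclicSteps (rot (a ∷ as) (b ∷ bs)) =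
  rot-≡ (stepsFrom a (as ++ b ∷ [])) (stepsFrom b (bs ++ a ∷ [])) (cyclicSteps-rot a as b bs) (cyclicSteps-rot b bs a as)

-- Distinctness matters: between two equal letters the weak step would be up in both directions.
steps-reverse : ∀ {w} → Unique w → steps (reverse w) ≡ flipReverse (steps w)
steps-reverse {[]} u = refl
steps-reverse {x ∷ []} u = refl
steps-reverse {x ∷ y ∷ ys} ((x≢y ∷ _) ∷ u) = begin
  steps (reverse (x ∷ y ∷ ys))                ≡⟨ cong steps (unfold-reverse x (y ∷ ys)) ⟩
  steps (reverse (y ∷ ys) ++ x ∷ [])          ≡⟨ snoc (reverse (y ∷ ys)) (last-reverse (y ∷ ys)) (unfold-reverse y ys) ⟩
  steps (reverse (y ∷ ys)) ++ (y ≤ᵇ x) ∷ []   ≡⟨ cong₂ (λ s e → s ++ e ∷ []) (steps-reverse u) (≤ᵇ-flip x≢y) ⟩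
  flipReverse (stepsFrom y ys) ++ not (x ≤ᵇ y) ∷ [] ∎
  where
  open ≡-Reasoning
  snoc : ∀ zs → last zs ≡ y → ∀ {vs} → zs ≡ vs ++ y ∷ [] → steps (zs ++ x ∷ []) ≡ steps zs ++ (y ≤ᵇ x) ∷ []
  snoc []       _  {[]}    ()
  snoc []       _  {_ ∷ _} ()
  snoc (z ∷ zs) eq _ = trans (stepsFrom-∷ʳ z zs x) (cong (λ e → stepsFrom z zs ++ (e ≤ᵇ x) ∷ []) eq)

OrderPreservingOn : List ℕ → (ℕ → ℕ) → Set
OrderPreservingOn w f = ∀ {x y} → x ∈ w → y ∈ w → (f x ≤ᵇ f y) ≡ (x ≤ᵇ y)

steps-map : ∀ {f} w → OrderPreservingOn w f → steps (map f w) ≡ steps w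
steps-map []           op = refl
steps-map (x ∷ [])     op = refl
steps-map (x ∷ y ∷ ys) op = cong₂ _∷_ (op (here refl) (there (here refl))) (steps-map (y ∷ ys) (λ p q → op (there p) (there q)))

last-map : ∀ f x xs → last (map f (x ∷ xs)) ≡ f (last (x ∷ xs))
last-map f x []       = refl
last-map f x (y ∷ xs) = last-map f y xs

cyclicSteps-map : ∀ {f} w → OrderPreservingOn w f → cyclicSteps (map f w) ≡ cyclicSteps w
cyclicSteps-map []       op = refl
cyclicSteps-map {f} (x ∷ xs) op = begin
  cyclicSteps (map f (x ∷ xs))                                    ≡⟨ cyclicSteps-∷ (f x) (map f xs) ⟩
  steps (map f (x ∷ xs)) ++ (last (map f (x ∷ xs)) ≤ᵇ f x) ∷ []   ≡⟨ cong₂ (λ s e → s ++ e ∷ []) (steps-map (x ∷ xs) op)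
      (trans (cong (_≤ᵇ f x) (last-map f x xs)) (op (last∈ x xs) (here refl))) ⟩
  steps (x ∷ xs) ++ (last (x ∷ xs) ≤ᵇ x) ∷ []                     ≡⟨ cyclicSteps-∷ x xs ⟨
  cyclicSteps (x ∷ xs)                                            ∎
  where open ≡-Reasoning

-- The empty word is excluded, although its empty step sequence is a path: an excursion has one
-- letter more than steps, hence odd length.
Excursion : List ℕ → Set
Excursion []       = ⊥
Excursion (x ∷ xs) = Path 0 (stepsFrom x xs) 0

excursion-map : ∀ {f} w → OrderPreservingOn w f → Excursion w → Excursion (map f w)
excursion-map (x ∷ xs) op = subst (λ s → Path 0 s 0) (sym (steps-map (x ∷ xs) op))

excursion-unmap : ∀ {f} w → OrderPreservingOn w f → Excursion (map f w) → Excursion w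
excursion-unmap (x ∷ xs) op = subst (λ s → Path 0 s 0) (steps-map (x ∷ xs) op)

-- The form in which `cycles` lists a cycle. Fixing the starting letter keeps rotations of one cycle
-- from being counted separately.
record MinFirstBalanced (w : List ℕ) : Set where
  constructor minFirstBalanced
  field
    minFirst : All (first w ≤_) w
    balanced : AlmostBalanced (cyclicSteps w)

excursion-reverse : ∀ {w} → Unique w → Excursion w → Excursion (reverse w)
excursion-reverse {x ∷ xs} u π =
  fill (reverse (x ∷ xs)) (unfold-reverse x xs) (subst (λ s → Path 0 s 0) (sym (steps-reverse u)) (path-flipReverse π))
  where
  fill : ∀ zs {vs} → zs ≡ vs ++ x ∷ [] → Path 0 (steps zs) 0 → Excursion zs
  fill []       {[]}    ()
  fill []       {_ ∷ _} ()
  fill (z ∷ zs) _ π = π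

-- Descents and ascents as counts of steps

<ᵇ-suc : ∀ x y → (x <ᵇ suc y) ≡ (x ≤ᵇ y)
<ᵇ-suc zero    y = refl
<ᵇ-suc (suc x) y = refl

<ᵇ≡not≤ᵇ : ∀ x y → (y <ᵇ x) ≡ not (x ≤ᵇ y)
<ᵇ≡not≤ᵇ zero    y       = refl
<ᵇ≡not≤ᵇ (suc x) zero    = refl
<ᵇ≡not≤ᵇ (suc x) (suc y) = trans (<ᵇ≡not≤ᵇ x y) (cong not (sym (<ᵇ-suc x y)))

isUp : ℕ × ℕ → Bool
isUp (x , y) = x ≤ᵇ y

steps≡isUp : ∀ w → map isUp (adjPairs w) ≡ steps w
steps≡isUp []           = refl
steps≡isUp (x ∷ [])     = refl
steps≡isUp (x ∷ y ∷ ys) = cong ((x ≤ᵇ y) ∷_) (steps≡isUp (y ∷ ys))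

DistinctPair : ℕ × ℕ → Set
DistinctPair (x , y) = x ≢ y

adjPairs-distinct : ∀ {w} → Unique w → All DistinctPair (adjPairs w)
adjPairs-distinct {[]}         u = []
adjPairs-distinct {x ∷ []}     u = []
adjPairs-distinct {x ∷ y ∷ ys} ((x≢y ∷ _) ∷ u) = x≢y ∷ adjPairs-distinct u

countᵇ≡ups : ∀ {A : Set} (q f : A → Bool) {l} → All (λ x → q x ≡ f x) l → countᵇ q l ≡ ups (map f l)
countᵇ≡ups q f [] = refl
countᵇ≡ups q f {x ∷ l} (e ∷ es) with q x | f x | e
... | true  | _ | refl = cong suc (countᵇ≡ups q f es)
... | false | _ | refl = countᵇ≡ups q f es

countᵇ≡downs : ∀ {A : Set} (q f : A → Bool) {l} → All (λ x → q x ≡ not (f x)) l → countᵇ q l ≡ downs (map f l)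
countᵇ≡downs q f [] = refl
countᵇ≡downs q f {x ∷ l} (e ∷ es) with q x | f x | e
... | true  | false | refl = cong suc (countᵇ≡downs q f es)
... | false | true  | refl = countᵇ≡downs q f es

countᵇ-isDes : ∀ l → countᵇ isDes l ≡ downs (map isUp l)
countᵇ-isDes l = countᵇ≡downs isDes isUp (All.universal (λ (x , y) → <ᵇ≡not≤ᵇ x y) l)

countᵇ-isAsc : ∀ {l} → All DistinctPair l → countᵇ isAsc l ≡ ups (map isUp l)
countᵇ-isAsc = countᵇ≡ups isAsc isUp ∘ All.map (λ { {x , y} x≢y →
  trans (<ᵇ≡not≤ᵇ y x) (sym (≤ᵇ-flip (x≢y ∘ sym))) })

des≡downs : ∀ w → des w ≡ downs (steps w)
des≡downs w = trans (countᵇ-isDes (adjPairs w)) (cong downs (steps≡isUp w))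

-- Uniqueness of the excursion among the rotations of a word

isPerm-↭ : ∀ {m v w} → v ↭ w → IsPerm m v → IsPerm m w
isPerm-↭ r (isPerm l u bs) =
  isPerm (trans (↭-length (↭-sym r)) l) (Permₛ.Unique-resp-↭ (setoid ℕ) (↭⇒↭ₛ r) u) (All-resp-↭ r bs)

rot⇒↭ : ∀ {A : Set} {xs ys : List A} → Rot xs ys → xs ↭ ys
rot⇒↭ (rot as bs) = ++-comm as bs

disjoint-++ : ∀ {A : Set} {x : A} xs {ys} → Unique (xs ++ ys) → x ∈ xs → x ∉ ys
disjoint-++ (x ∷ xs) u (here refl) x∈ = unique⇒∉ u (∈-++⁺ʳ xs x∈)
disjoint-++ (_ ∷ xs) (_ ∷ u) (there x∈) = disjoint-++ xs u x∈

rot-first-≡ : ∀ {v w} → Unique v → Rot v w → first v ≡ first w → v ≡ w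
rot-first-≡ u (rot [] bs) _ = sym (++-identityʳ bs)
rot-first-≡ u (rot as@(_ ∷ _) []) _ = ++-identityʳ as
rot-first-≡ u (rot (a ∷ as) (b ∷ bs)) refl = contradiction (here refl) (disjoint-++ (a ∷ as) u (here refl))

-- An up-step right after a prefix p of the excursion would force the remaining steps s to have
-- negative sum, although s starts another excursion.
no-up-rotation : ∀ {p s t} → Path 0 (p ++ true ∷ s) 0 → Path 0 (s ++ t) 0 → ⊥
no-up-rotation {p} {s} π ρ with path-split p π | path-split s ρ
... | a , _ , up σ | b , τ , _ =
  m+1+n≢n (a + b) (trans (regroup a b (downs s)) (trans (cong (suc a +_) (sym (path-sum τ))) (path-sum σ)))
  where
  regroup : ∀ a b n → (a + b) + suc n ≡ suc a + (b + n)
  regroup = solve-∀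

-- In the first path `s` leads from some height `a` down to 0, so its sum is not positive. In the
-- second it must rise to some `suc b`, since a down-step follows.
no-down-rotation : ∀ {p s} → Path 0 (p ++ false ∷ s) 0 → Path 0 (s ++ false ∷ p) 0 → ⊥
no-down-rotation {p} {s} π ρ with path-split p π | path-split s ρ
... | suc a , _ , down σ | suc b , τ , _ =
  m+1+n≢n (a + b) (trans (regroup a b (downs s)) (trans (cong (a +_) (sym (path-sum τ))) (path-sum σ)))
  where
  regroup : ∀ a b n → (a + b) + suc n ≡ a + (suc b + n)
  regroup = solve-∀

-- The uniqueness half of the cycle lemma. A proper rotation exchanges two blocks of steps; the
-- steps joining the blocks in the two words can neither include an up-step nor both be down-steps.
excursion-rot-≡ : ∀ {v w} → Rot v w → Excursion v → Excursion w → v ≡ w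
excursion-rot-≡ (rot [] bs) _ _ = sym (++-identityʳ bs)
excursion-rot-≡ (rot as@(_ ∷ _) []) _ _ = ++-identityʳ as
excursion-rot-≡ (rot (a ∷ as) (b ∷ bs)) π ρ =
  ⊥-elim (absurd (subst (λ s → Path 0 s 0) (steps-++ a as b bs) π)
                 (subst (λ s → Path 0 s 0) (steps-++ b bs a as) ρ))
  where
  absurd : ∀ {x y s t} → Path 0 (s ++ x ∷ t) 0 → Path 0 (t ++ y ∷ s) 0 → ⊥
  absurd {true}          π ρ = no-up-rotation π ρ
  absurd {false} {true}  π ρ = no-up-rotation ρ π
  absurd {false} {false} π ρ = no-down-rotation π ρ

excursion-from-cyclic : ∀ w {t x} → cyclicSteps w ≡ t ++ x ∷ [] → Path 0 t 0 → Excursion w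
excursion-from-cyclic []       {[]}    ()
excursion-from-cyclic []       {_ ∷ _} ()
excursion-from-cyclic (y ∷ ys) {t} eq π =
  subst (λ s → Path 0 s 0) (sym (∷ʳ-injectiveˡ (stepsFrom y ys) t (trans (sym (cyclicSteps-∷ y ys)) eq))) π

excursion-almostBalanced : ∀ w → Excursion w → AlmostBalanced (cyclicSteps w)
excursion-almostBalanced (x ∷ xs) π = subst AlmostBalanced (sym (cyclicSteps-∷ x xs)) (go (last (x ∷ xs) ≤ᵇ x) (path-sum π))
  where
  s = stepsFrom x xs
  go : ∀ e → ups s ≡ downs s → AlmostBalanced (s ++ e ∷ [])
  go true  eq = inj₁ (trans (ups-++ s _) (trans (+-comm _ 1) (cong suc (trans eq (sym (trans (downs-++ s _) (+-identityʳ _)))))))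
  go false eq = inj₂ (trans (downs-++ s _) (trans (+-comm _ 1) (cong suc (trans (sym eq) (sym (trans (ups-++ s _) (+-identityʳ _)))))))

first∈ : ∀ {w x} → x ∈ w → first w ∈ w
first∈ {_ ∷ _} _ = here refl

perm-first≡1 : ∀ {m w} → IsPerm (suc m) w → MinFirstBalanced w → first w ≡ 1
perm-first≡1 isP (minFirstBalanced min _) =
  ≤-antisym (All.lookup min 1∈) (proj₁ (All.lookup (bounds isP) (first∈ 1∈)))
  where 1∈ = perm-full isP (≤-refl , s≤s z≤n)

-- Rotation itself is the bijection. Towards excursions, existence is the cycle lemma and uniqueness
-- `excursion-rot-≡`; backwards, the word is rotated to start at 1, and distinct letters leave one
-- way to do so.
card-excursion : ∀ {m n} → Card (λ w → IsPerm (suc m) w × MinFirstBalanced w) n →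
                 Card (λ w → IsPerm (suc m) w × Excursion w) n
card-excursion {m} = card-bij Rot total onto
  (λ _ (_ , π) (_ , ρ) r r′ → excursion-rot-≡ (rot-join r r′) π ρ)
  (λ (i , g) (i′ , g′) _ r r′ → rot-first-≡ (distinct i) (rot-trans r (rot-sym r′))
                                   (trans (perm-first≡1 i g) (sym (perm-first≡1 i′ g′))))
  where
  total : ∀ {w} → IsPerm (suc m) w × MinFirstBalanced w → ∃ λ v → (IsPerm (suc m) v × Excursion v) × Rot w v
  total {w} (i , minFirstBalanced _ bal) with cycleLemma (cyclicSteps w) bal
  ... | t , x , r , π with cyclicSteps-rot⁻ r
  ... | v , r′ , eq = v , (isPerm-↭ (rot⇒↭ r′) i , excursion-from-cyclic v eq π) , r′
  onto : ∀ {v} → IsPerm (suc m) v × Excursion v → ∃ λ w → (IsPerm (suc m) w × MinFirstBalanced w) × Rot w v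
  onto {v} (i , π) with ∈-∃++ (perm-full i (≤-refl , s≤s z≤n))
  ... | as , bs , refl = (1 ∷ bs) ++ as , (i′ , minFirstBalanced (All.map proj₁ (bounds i′)) bal) , rot (1 ∷ bs) as
    where
    i′ = isPerm-↭ (rot⇒↭ (rot as (1 ∷ bs))) i
    bal = almostBalanced-rot (rot-cyclicSteps (rot as (1 ∷ bs))) (excursion-almostBalanced v π)

-- Balanced cycles and Eulerian numbers

double-injective : ∀ {m n} → m + m ≡ n + n → m ≡ n
double-injective {zero}  {zero}  _  = refl
double-injective {suc m} {suc n} eq = cong suc (double-injective
  (suc-injective (trans (sym (+-suc m m)) (trans (suc-injective eq) (+-suc n n)))))

-- For an odd total the two middle values of `d` are exactly those where the counts differ by one.
-- This ties the two Eulerian numbers behind `EC` to balance.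
middle : ∀ {u d i} → u + d ≡ suc (i + i) →
         (d ≡ i ⊎ d ≡ suc i → u ≡ suc d ⊎ d ≡ suc u) × (u ≡ suc d ⊎ d ≡ suc u → d ≡ i ⊎ d ≡ suc i)
middle {u} {d} {i} eq = to , from
  where
  to : d ≡ i ⊎ d ≡ suc i → u ≡ suc d ⊎ d ≡ suc u
  to (inj₁ refl) = inj₁ (+-cancelʳ-≡ d u (suc d) eq)
  to (inj₂ refl) = inj₂ (cong suc (sym (+-cancelʳ-≡ (suc i) u i (trans eq (sym (+-suc i i))))))
  from : u ≡ suc d ⊎ d ≡ suc u → d ≡ i ⊎ d ≡ suc i
  from (inj₁ refl) = inj₁ (double-injective (suc-injective eq))
  from (inj₂ refl) = inj₂ (cong suc (double-injective (suc-injective (trans (sym (+-suc u u)) eq))))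

steps-total : ∀ {m w} → IsPerm (suc m) w → ups (steps w) + downs (steps w) ≡ m
steps-total {w = x ∷ xs} i = trans (ups+downs (stepsFrom x xs)) (trans (length-stepsFrom x xs) (suc-injective (len i)))

isPerm-reverse : ∀ {m w} → IsPerm m w → IsPerm m (reverse w)
isPerm-reverse {w = w} = isPerm-↭ (↭-sym (↭-reverse w))

reverse-injective : ∀ {v w : List ℕ} → reverse v ≡ reverse w → v ≡ w
reverse-injective {v} {w} eq = trans (sym (reverse-involutive v)) (trans (cong reverse eq) (reverse-involutive w))

card-E : ∀ m d → Card (λ w → IsPerm m w × downs (steps w) ≡ d) (E m d)
card-E m d = card-⇔ (λ { {w} (i , t) → i , trans (sym (des≡downs w)) (≡ᵇ⇒≡ (des w) d t) })
                    (λ { {w} (i , e) → i , ≡⇒≡ᵇ (des w) d (trans (des≡downs w) e) })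
                    (card-perms-countᵇ m (λ w → des w ≡ᵇ d))

-- Symmetry of the Eulerian numbers: reversal exchanges ascents and descents.
card-E-reverse : ∀ m u d → u + d ≡ m → Card (λ w → IsPerm (suc m) w × downs (steps w) ≡ d) (E (suc m) u)
card-E-reverse m u d eq = card-bij (λ v w → w ≡ reverse v)
  (λ { {v} (i , e) → reverse v , swap i e eq , refl })
  (λ { {v} (i , e) → reverse v , swap i e (trans (+-comm d u) eq) , sym (reverse-involutive v) })
  (λ { _ _ _ refl refl → refl })
  (λ { _ _ _ r r′ → reverse-injective (trans (sym r) r′) })
  (card-E (suc m) u)
  where
  swap : ∀ {w u d} → IsPerm (suc m) w → downs (steps w) ≡ u → u + d ≡ m →
         IsPerm (suc m) (reverse w) × downs (steps (reverse w)) ≡ d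
  swap {w} {d = d} i refl eq = isPerm-reverse i ,
    trans (cong downs (steps-reverse (distinct i))) (trans (downs-flipReverse (steps w))
      (+-cancelʳ-≡ (downs (steps w)) (ups (steps w)) d (trans (steps-total i) (trans (sym eq) (+-comm _ d)))))

-- The letter 1 lies below all others, so the cycle leaves it by an ascent and returns to it by a
-- descent.
cyclicSteps-1∷ : ∀ {m w} → IsPerm (suc m) w → cyclicSteps (1 ∷ map suc w) ≡ true ∷ steps w ++ false ∷ []
cyclicSteps-1∷ {w = x ∷ xs} (isPerm _ _ bs) = cong (true ∷_) (trans (stepsFrom-∷ʳ (suc x) (map suc xs) 1)
  (cong₂ (λ s e → s ++ e ∷ []) (steps-map (x ∷ xs) (λ {a} {b} _ _ → <ᵇ-suc a b))
     (trans (cong (_≤ᵇ 1) (last-map suc x xs)) (suc≰1 (proj₁ (All.lookup bs (last∈ x xs)))))))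
  where
  suc≰1 : ∀ {n} → 1 ≤ n → (suc n ≤ᵇ 1) ≡ false
  suc≰1 (s≤s _) = refl

almostBalanced-1∷ : ∀ s → (AlmostBalanced (true ∷ s ++ false ∷ []) → AlmostBalanced s) ×
                          (AlmostBalanced s → AlmostBalanced (true ∷ s ++ false ∷ []))
almostBalanced-1∷ s rewrite ups-++ s (false ∷ []) | downs-++ s (false ∷ []) | +-identityʳ (ups s) | +-comm (downs s) 1 =
  Sum.map suc-injective suc-injective , Sum.map (cong suc) (cong suc)

isPerm-1∷ : ∀ {m w} → IsPerm m w → IsPerm (suc m) (1 ∷ map suc w)
isPerm-1∷ {m} {w} (isPerm l u bs) =
  isPerm (cong suc (trans (length-map suc w) l))
    (∉⇒unique (λ 1∈ → let y , y∈ , eq = ∈-map⁻ suc 1∈ in <⇒≢ (proj₁ (All.lookup bs y∈)) (suc-injective eq)) (Uniq.map⁺ suc-injective u))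
    ((≤-refl , s≤s z≤n) ∷ Allₚ.map⁺ (All.map (λ (_ , y≤) → s≤s z≤n , s≤s y≤) bs))

isPerm-1∷⁻ : ∀ {m v} → IsPerm (suc m) v → first v ≡ 1 → ∃ λ w → IsPerm m w × v ≡ 1 ∷ map suc w
isPerm-1∷⁻ {m} {x ∷ v} (isPerm l u@(_ ∷ u′) (_ ∷ bs)) refl =
  let w , eq , bs′ = shift v (unique⇒∉ u) bs
  in w , isPerm (trans (sym (length-map suc w)) (trans (cong length (sym eq)) (suc-injective l)))
                (Uniq.map⁻ (subst Unique eq u′)) bs′ , cong (1 ∷_) eq
  where
  shift : ∀ v → 1 ∉ v → All (_∈[1, suc m ]) v → ∃ λ w → v ≡ map suc w × All (_∈[1, m ]) w
  shift [] _ _ = [] , refl , []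
  shift (zero ∷ v) _ ((() , _) ∷ _)
  shift (suc zero ∷ v) 1∉ _ = contradiction (here refl) 1∉
  shift (suc (suc y) ∷ v) 1∉ ((_ , s≤s y≤) ∷ bs) =
    let w , eq , bs′ = shift v (1∉ ∘ there) bs in suc y ∷ w , cong (suc (suc y) ∷_) eq , (s≤s z≤n , y≤) ∷ bs′

perm1 : ∀ {w} → IsPerm 1 w → w ≡ 1 ∷ []
perm1 {x ∷ []} (isPerm _ _ ((1≤x , x≤1) ∷ [])) = cong (_∷ []) (≤-antisym x≤1 1≤x)

-- By minimality the first letter is 1. Deleting it and lowering the rest leaves a permutation whose
-- number of descents is one of the two middle values; by symmetry each value accounts for the same
-- Eulerian number. For `zero` only the fixed point remains.
card-minFirstBalanced : ∀ j → Card (λ w → IsPerm (suc (j + j)) w × MinFirstBalanced w) (EC j)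
card-minFirstBalanced zero = mkCard ((1 ∷ []) ∷ []) ([] ∷ [])
  (λ { (here refl) → isPerm refl ([] ∷ []) ((≤-refl , ≤-refl) ∷ []) , minFirstBalanced (≤-refl ∷ []) (inj₁ refl) })
  (λ (i , _) → here (perm1 i)) refl
card-minFirstBalanced (suc i) =
  card-bij (λ v w → w ≡ 1 ∷ map suc v) total onto (λ { _ _ _ refl refl → refl })
    (λ { _ _ _ refl eq → map-injective suc-injective (∷-injectiveʳ eq) })
    (card-⊎ (λ { (_ , refl) (_ , eq) → contradiction (sym eq) 1+n≢n }) cardE cardE′)
  where
  m = i + suc i
  2*suc : 2 * suc i ≡ suc m
  2*suc = cong (λ z → suc (i + suc z)) (+-identityʳ i)
  m≡ : m ≡ suc (i + i)
  m≡ = +-suc i i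
  cardE : Card (λ w → IsPerm (suc m) w × downs (steps w) ≡ i) (E (2 * suc i) i)
  cardE = subst (Card _) (cong (λ z → E z i) (sym 2*suc)) (card-E (suc m) i)
  -- The trailing `+ 0` comes from unfolding the doubling in `EC (suc i)`.
  cardE′ : Card (λ w → IsPerm (suc m) w × downs (steps w) ≡ suc i) (E (2 * suc i) i + 0)
  cardE′ = subst (Card _) (trans (cong (λ z → E z i) (sym 2*suc)) (sym (+-identityʳ _))) (card-E-reverse m i (suc i) refl)
  total : ∀ {v} → (IsPerm (suc m) v × downs (steps v) ≡ i) ⊎ (IsPerm (suc m) v × downs (steps v) ≡ suc i) →
          ∃ λ w → (IsPerm (suc (suc m)) w × MinFirstBalanced w) × w ≡ 1 ∷ map suc v
  total {v} h = 1 ∷ map suc v , (i′ , minFirstBalanced (All.map proj₁ (bounds i′)) bal) , refl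
    where
    isP = [ proj₁ , proj₁ ]′ h
    i′ = isPerm-1∷ isP
    bal = subst AlmostBalanced (sym (cyclicSteps-1∷ isP)) (proj₂ (almostBalanced-1∷ (steps v))
            (proj₁ (middle (trans (steps-total isP) m≡)) (Sum.map proj₂ proj₂ h)))
  onto : ∀ {w} → IsPerm (suc (suc m)) w × MinFirstBalanced w →
         ∃ λ v → ((IsPerm (suc m) v × downs (steps v) ≡ i) ⊎ (IsPerm (suc m) v × downs (steps v) ≡ suc i)) × w ≡ 1 ∷ map suc v
  onto {w} (isP , g) with isPerm-1∷⁻ isP (perm-first≡1 isP g)
  ... | v , isP′ , refl = v , Sum.map (isP′ ,_) (isP′ ,_) (proj₂ (middle (trans (steps-total isP′) m≡))
          (proj₁ (almostBalanced-1∷ (steps v)) (subst AlmostBalanced (cyclicSteps-1∷ isP′) (MinFirstBalanced.balanced g)))) , refl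

-- Shuffling two relabelled words

-- A choice of `k` entries together with its complement, both in the order of `xs`. Inside an
-- increasing list each part is thus the normal form of a letter set.
data Split : ℕ → List ℕ → List ℕ → List ℕ → Set where
  []    : Split 0 [] [] []
  left  : ∀ {k x xs as bs} → Split k xs as bs → Split (suc k) (x ∷ xs) (x ∷ as) bs
  right : ∀ {k x xs as bs} → Split k xs as bs → Split k (x ∷ xs) as (x ∷ bs)

split-lengthˡ : ∀ {k xs as bs} → Split k xs as bs → length as ≡ k
split-lengthˡ []        = refl
split-lengthˡ (left s)  = cong suc (split-lengthˡ s)
split-lengthˡ (right s) = split-lengthˡ s

split-length : ∀ {k xs as bs} → Split k xs as bs → k + length bs ≡ length xs
split-length []            = refl
split-length (left s)      = cong suc (split-length s)
split-length {k} (right s) = trans (+-suc k _) (cong suc (split-length s))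

split-∈ˡ : ∀ {k xs as bs x} → Split k xs as bs → x ∈ as → x ∈ xs
split-∈ˡ (left s)  (here eq)  = here eq
split-∈ˡ (left s)  (there x∈) = there (split-∈ˡ s x∈)
split-∈ˡ (right s) x∈         = there (split-∈ˡ s x∈)

split-∈ʳ : ∀ {k xs as bs x} → Split k xs as bs → x ∈ bs → x ∈ xs
split-∈ʳ (left s)  x∈         = there (split-∈ʳ s x∈)
split-∈ʳ (right s) (here eq)  = here eq
split-∈ʳ (right s) (there x∈) = there (split-∈ʳ s x∈)

split-∈⁻ : ∀ {k xs as bs x} → Split k xs as bs → x ∈ xs → x ∈ as ⊎ x ∈ bs
split-∈⁻ (left s)  (here eq)  = inj₁ (here eq)
split-∈⁻ (left s)  (there x∈) = Sum.map₁ there (split-∈⁻ s x∈)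
split-∈⁻ (right s) (here eq)  = inj₂ (here eq)
split-∈⁻ (right s) (there x∈) = Sum.map₂ there (split-∈⁻ s x∈)

split-disjoint : ∀ {k xs as bs x} → Unique xs → Split k xs as bs → x ∈ as → x ∉ bs
split-disjoint u       (left s)  (here refl) x∈bs        = unique⇒∉ u (split-∈ʳ s x∈bs)
split-disjoint (_ ∷ u) (left s)  (there x∈)  x∈bs        = split-disjoint u s x∈ x∈bs
split-disjoint u       (right s) x∈          (here refl) = unique⇒∉ u (split-∈ˡ s x∈)
split-disjoint (_ ∷ u) (right s) x∈          (there x∈b) = split-disjoint u s x∈ x∈b

split-increasing : ∀ {k xs as bs} → Increasing xs → Split k xs as bs → Increasing as × Increasing bs
split-increasing [] [] = [] , []
split-increasing (x< ∷ inc) (left s) =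
  let ia , ib = split-increasing inc s in All.tabulate (All.lookup x< ∘ split-∈ˡ s) ∷ ia , ib
split-increasing (x< ∷ inc) (right s) =
  let ia , ib = split-increasing inc s in ia , All.tabulate (All.lookup x< ∘ split-∈ʳ s) ∷ ib

splitBy : ∀ us xs → ∃₂ λ k as → ∃ λ bs → Split k xs as bs × (∀ {x} → x ∈ as → x ∈ us) × (∀ {x} → x ∈ bs → x ∉ us)
splitBy us [] = 0 , [] , [] , [] , (λ ()) , (λ ())
splitBy us (x ∷ xs) with x ∈? us | splitBy us xs
... | yes x∈ | k , as , bs , s , f , g = suc k , x ∷ as , bs , left s , (λ { (here refl) → x∈ ; (there y∈) → f y∈ }) , g
... | no x∉  | k , as , bs , s , f , g = k , as , x ∷ bs , right s , f , (λ { (here refl) → x∉ ; (there y∈) → g y∈ })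

IsSplit : ℕ → List ℕ → List ℕ × List ℕ → Set
IsSplit k xs (as , bs) = Split k xs as bs

-- Pascal's rule: the head of the list is chosen or not.
card-split : ∀ {xs} k → Unique xs → Card (IsSplit k xs) (length xs C k)
card-split {[]} zero    _ = mkCard (([] , []) ∷ []) ([] ∷ []) (λ { (here refl) → [] }) (λ { [] → here refl }) refl
card-split {[]} (suc k) _ = mkCard [] [] (λ ()) (λ ()) (sym (k>n⇒nCk≡0 (s≤s (z≤n {k}))))
card-split {x ∷ xs} zero (_ ∷ u) = card-bij (λ (as , bs) (as′ , bs′) → as′ ≡ as × bs′ ≡ x ∷ bs)
  (λ { {as , bs} s → (as , x ∷ bs) , right s , refl , refl })
  (λ { (right s) → _ , s , refl , refl })
  (λ { _ _ _ (refl , refl) (refl , refl) → refl })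
  (λ { _ _ _ (refl , refl) (refl , refl) → refl })
  (card-split zero u)
card-split {x ∷ xs} (suc k) u@(_ ∷ u′) =
  subst (Card _) (nCk+nC[k+1]≡[n+1]C[k+1] (length xs) k)
    (card-⇔ [ (λ { (_ , refl , s) → left s }) , (λ { (_ , refl , s) → right s }) ]′
            (λ { (left s) → inj₁ (_ , refl , s) ; (right s) → inj₂ (_ , refl , s) })
            (card-⊎ (λ { (_ , refl , s) (_ , refl , s′) → unique⇒∉ u (split-∈ˡ s′ (here refl)) }) lefts rights))
  where
  lefts : Card (λ (as , bs) → ∃ λ as′ → as ≡ x ∷ as′ × Split k xs as′ bs) (length xs C k)
  lefts = card-bij (λ (as , bs) (as′ , bs′) → as′ ≡ x ∷ as × bs′ ≡ bs)
    (λ { {as , bs} s → (x ∷ as , bs) , (as , refl , s) , refl , refl })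
    (λ { {_ , bs} (as , refl , s) → (as , bs) , s , refl , refl })
    (λ { _ _ _ (refl , refl) (refl , refl) → refl })
    (λ { _ _ _ (refl , refl) (refl , refl) → refl })
    (card-split k u′)
  rights : Card (λ (as , bs) → ∃ λ bs′ → bs ≡ x ∷ bs′ × Split (suc k) xs as bs′) (length xs C suc k)
  rights = card-bij (λ (as , bs) (as′ , bs′) → as′ ≡ as × bs′ ≡ x ∷ bs)
    (λ { {as , bs} s → (as , x ∷ bs) , (bs , refl , s) , refl , refl })
    (λ { {as , _} (bs , refl , s) → (as , bs) , s , refl , refl })
    (λ { _ _ _ (refl , refl) (refl , refl) → refl })
    (λ { _ _ _ (refl , refl) (refl , refl) → refl })
    (card-split (suc k) u′)

-- Relabelling by an increasing list of letters

app-∈ : ∀ {as i} → i ∈[1, length as ] → app as i ∈ as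
app-∈ {_ ∷ _}  {suc zero}    _             = here refl
app-∈ {_ ∷ as} {suc (suc i)} (_ , s≤s i≤)  = there (app-∈ {as} (s≤s z≤n , i≤))

∈-app : ∀ {as x} → x ∈ as → ∃ λ i → i ∈[1, length as ] × app as i ≡ x
∈-app (here refl) = 1 , (≤-refl , s≤s z≤n) , refl
∈-app {a ∷ as} (there x∈) with ∈-app x∈
... | suc i , (_ , i≤) , eq = suc (suc i) , (s≤s z≤n , s≤s i≤) , eq

app-mono-< : ∀ {as i j} → Increasing as → i ∈[1, length as ] → j ∈[1, length as ] → i < j → app as i < app as j
app-mono-< {_ ∷ as} {suc zero} {suc (suc j)} (a< ∷ _) _ (_ , s≤s j≤) _ = All.lookup a< (app-∈ {as} (s≤s z≤n , j≤))
app-mono-< {_ ∷ as} {suc (suc i)} {suc (suc j)} (_ ∷ inc) (_ , s≤s i≤) (_ , s≤s j≤) (s≤s i<j) =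
  app-mono-< {as} inc (s≤s z≤n , i≤) (s≤s z≤n , j≤) i<j
app-mono-< {_ ∷ _} {suc _} {suc zero} _ _ _ (s≤s ())

app-injective : ∀ {as i j} → Unique as → i ∈[1, length as ] → j ∈[1, length as ] → app as i ≡ app as j → i ≡ j
app-injective {_ ∷ _}  {suc zero}    {suc zero}    _ _ _ _ = refl
app-injective {_ ∷ as} {suc zero}    {suc (suc j)} u _ (_ , s≤s j≤) refl =
  contradiction (app-∈ {as} (s≤s z≤n , j≤)) (unique⇒∉ u)
app-injective {_ ∷ as} {suc (suc i)} {suc zero}    u (_ , s≤s i≤) _ refl =
  contradiction (app-∈ {as} (s≤s z≤n , i≤)) (unique⇒∉ u)
app-injective {_ ∷ as} {suc (suc i)} {suc (suc j)} (_ ∷ u) (_ , s≤s i≤) (_ , s≤s j≤) eq =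
  cong suc (app-injective {as} u (s≤s z≤n , i≤) (s≤s z≤n , j≤) eq)

≤ᵇ-true : ∀ {x y} → x ≤ y → (x ≤ᵇ y) ≡ true
≤ᵇ-true {x} {y} x≤y with x ≤ᵇ y | ≤⇒≤ᵇ x≤y
... | true | _ = refl

≤ᵇ-false : ∀ {x y} → y < x → (x ≤ᵇ y) ≡ false
≤ᵇ-false {x} {y} y<x with x ≤ᵇ y in eq
... | true  = contradiction (≤ᵇ⇒≤ x y (subst T (sym eq) _)) (<⇒≱ y<x)
... | false = refl

app-orderPreserving : ∀ {as v} → Increasing as → All (_∈[1, length as ]) v → OrderPreservingOn v (app as)
app-orderPreserving {as} inc bs {x} {y} x∈ y∈ with All.lookup bs x∈ | All.lookup bs y∈ | <-cmp x y
... | x∈r | y∈r | tri< x<y _ _ = trans (≤ᵇ-true (<⇒≤ (app-mono-< inc x∈r y∈r x<y))) (sym (≤ᵇ-true (<⇒≤ x<y)))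
... | x∈r | y∈r | tri≈ _ refl _ = trans (≤ᵇ-true {app as x} ≤-refl) (sym (≤ᵇ-true {x} ≤-refl))
... | x∈r | y∈r | tri> _ _ y<x = trans (≤ᵇ-false (app-mono-< inc y∈r x∈r y<x)) (sym (≤ᵇ-false y<x))

map-injectiveOn : ∀ {D : ℕ → Set} {f : ℕ → ℕ} → (∀ {x y} → D x → D y → f x ≡ f y → x ≡ y) →
                  ∀ {v w} → All D v → All D w → map f v ≡ map f w → v ≡ w
map-injectiveOn inj []       []       _  = refl
map-injectiveOn inj (d ∷ ds) (e ∷ es) eq = cong₂ _∷_ (inj d e (∷-injectiveˡ eq)) (map-injectiveOn inj ds es (∷-injectiveʳ eq))

map-uniqueOn : ∀ {D : ℕ → Set} {f : ℕ → ℕ} → (∀ {x y} → D x → D y → f x ≡ f y → x ≡ y) →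
               ∀ {v} → All D v → Unique v → Unique (map f v)
map-uniqueOn inj []       u = []
map-uniqueOn {f = f} inj {x ∷ v} (d ∷ ds) u@(_ ∷ u′) = ∉⇒unique notin (map-uniqueOn inj ds u′)
  where
  notin : f x ∉ map f v
  notin fx∈ with ∈-map⁻ f fx∈
  ... | y , y∈ , eq = unique⇒∉ u (subst (_∈ v) (sym (inj d (All.lookup ds y∈) eq)) y∈)

module _ {as : List ℕ} {k : ℕ} (inc : Increasing as) (eq : length as ≡ k) where

  -- Letter `i` becomes the `i`-th smallest entry of `as`: on `IsPerm k` this is the inverse of
  -- standardisation.
  relabel : List ℕ → List ℕ
  relabel = map (app as)

  private
    inRange : ∀ {v} → IsPerm k v → All (_∈[1, length as ]) v
    inRange i = subst (λ m → All (_∈[1, m ]) _) (sym eq) (bounds i)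

  relabel-unique : ∀ {v} → IsPerm k v → Unique (relabel v)
  relabel-unique i = map-uniqueOn (app-injective (increasing⇒unique inc)) (inRange i) (distinct i)

  relabel-⊆ : ∀ {v x} → IsPerm k v → x ∈ relabel v → x ∈ as
  relabel-⊆ i x∈ with ∈-map⁻ (app as) x∈
  ... | y , y∈ , refl = app-∈ (All.lookup (inRange i) y∈)

  relabel-⊇ : ∀ {v x} → IsPerm k v → x ∈ as → x ∈ relabel v
  relabel-⊇ i x∈ with ∈-app x∈
  ... | j , j∈ , refl = ∈-map⁺ (app as) (perm-full i (subst (j ∈[1,_]) eq j∈))

  relabel-injective : ∀ {v w} → IsPerm k v → IsPerm k w → relabel v ≡ relabel w → v ≡ w
  relabel-injective i i′ = map-injectiveOn (app-injective (increasing⇒unique inc)) (inRange i) (inRange i′)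

  relabel-orderPreserving : ∀ {v} → IsPerm k v → OrderPreservingOn v (app as)
  relabel-orderPreserving i = app-orderPreserving inc (inRange i)

  relabel-onto : ∀ {w} → Unique w → length w ≡ k → (∀ {x} → x ∈ w → x ∈ as) → ∃ λ v → IsPerm k v × w ≡ relabel v
  relabel-onto u l w⊆ =
    let v , e , bs = preimage w⊆
    in v , isPerm (trans (trans (sym (length-map (app as) v)) (cong length (sym e))) l) (Uniq.map⁻ (subst Unique e u))
                  (subst (λ m → All (_∈[1, m ]) v) eq bs) , e
    where
    preimage : ∀ {w} → (∀ {x} → x ∈ w → x ∈ as) → ∃ λ v → w ≡ relabel v × All (_∈[1, length as ]) v
    preimage {[]}    _  = [] , refl , []
    preimage {x ∷ w} w⊆ with ∈-app (w⊆ (here refl)) | preimage (w⊆ ∘ there)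
    ... | i , i∈ , e | v , e′ , bs = i ∷ v , cong₂ _∷_ (sym e) e′ , i∈ ∷ bs

increasing-range1 : ∀ m → Increasing (range1 m)
increasing-range1 m = AllPairsₚ.map⁺ (AllPairsₚ.applyUpTo⁺₁ id m (λ i<j _ → s≤s i<j))

-- Says that `P` depends only on the pattern of a word. Both directions are required, since words
-- are relabelled as well as standardised.
record OrderInvariant (P : List ℕ → Set) : Set where
  field
    relabelled   : ∀ {f} w → OrderPreservingOn w f → P w → P (map f w)
    unrelabelled : ∀ {f} w → OrderPreservingOn w f → P (map f w) → P w

open OrderInvariant

unique-++⁻ : ∀ {A : Set} (xs : List A) {ys} → Unique (xs ++ ys) → Unique xs × Unique ys
unique-++⁻ []       u = [] , u
unique-++⁻ (x ∷ xs) (x≢ ∷ u) = let ux , uy = unique-++⁻ xs u in Allₚ.++⁻ˡ xs x≢ ∷ ux , uy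

-- A pair amounts to the letter set of `v`, whose complement is that of `w`, and the two
-- standardised words. The letter set is recovered by splitting `range1 N` according to membership
-- in `v`.
card-concat : ∀ {P Q k l m n} → OrderInvariant P → OrderInvariant Q →
  Card (λ w → IsPerm k w × P w) m → Card (λ w → IsPerm l w × Q w) n →
  Card (λ (v , w) → IsPerm (k + l) (v ++ w) × length v ≡ k × P v × Q w) (((k + l) C k) * (m * n))
card-concat {P} {Q} {k} {l} {m} {n} invP invQ cP cQ =
  card-bij Relabels total onto (λ { _ _ _ (refl , refl) (refl , refl) → refl }) injective
    (card-× (subst (λ z → Card (IsSplit k (range1 (k + l))) (z C k)) (length-range1 (k + l)) (card-split k (unique-range1 (k + l)))) (card-× cP cQ))
  where
  N = k + l
  Source : (List ℕ × List ℕ) × (List ℕ × List ℕ) → Set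
  Source ((as , bs) , (v , w)) = Split k (range1 N) as bs × (IsPerm k v × P v) × (IsPerm l w × Q w)
  Target : List ℕ × List ℕ → Set
  Target (v , w) = IsPerm N (v ++ w) × length v ≡ k × P v × Q w
  Relabels : (List ℕ × List ℕ) × (List ℕ × List ℕ) → List ℕ × List ℕ → Set
  Relabels ((as , bs) , (v , w)) (v′ , w′) = v′ ≡ map (app as) v × w′ ≡ map (app bs) w
  lengthʳ : ∀ {as bs} → Split k (range1 N) as bs → length bs ≡ l
  lengthʳ s = +-cancelˡ-≡ k _ l (trans (split-length s) (length-range1 N))
  incs : ∀ {as bs} → Split k (range1 N) as bs → Increasing as × Increasing bs
  incs = split-increasing (increasing-range1 N)
  total : ∀ {x} → Source x → ∃ λ y → Target y × Relabels x y
  total {(as , bs) , (v , w)} (s , (iv , pv) , (iw , qw)) =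
    (map (app as) v , map (app bs) w) ,
    (isPerm (trans (length-++ (map (app as) v)) (cong₂ _+_ lenv (trans (length-map _ w) (len iw))))
            (Uniq.++⁺ (relabel-unique ia la iv) (relabel-unique ib lb iw)
               λ (x∈ , x∈′) → split-disjoint (unique-range1 N) s (relabel-⊆ ia la iv x∈) (relabel-⊆ ib lb iw x∈′))
            (Allₚ.++⁺ (All.tabulate (range1⁻ ∘ split-∈ˡ s ∘ relabel-⊆ ia la iv))
                      (All.tabulate (range1⁻ ∘ split-∈ʳ s ∘ relabel-⊆ ib lb iw))) ,
     lenv ,
     relabelled invP v (relabel-orderPreserving ia la iv) pv , relabelled invQ w (relabel-orderPreserving ib lb iw) qw) ,
    refl , refl
    where
    ia = proj₁ (incs s)
    ib = proj₂ (incs s)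
    la = split-lengthˡ s
    lb = lengthʳ s
    lenv = trans (length-map (app as) v) (len iv)
  onto : ∀ {y} → Target y → ∃ λ x → Source x × Relabels x y
  onto {v′ , w′} (i , lv , pv , qw) with splitBy v′ (range1 N)
  ... | k′ , as , bs , s , as⊆ , bs∉ = build k≡ s
    where
    uv = proj₁ (unique-++⁻ v′ (distinct i))
    uw = proj₂ (unique-++⁻ v′ (distinct i))
    v⊆ : ∀ {x} → x ∈ v′ → x ∈ as
    v⊆ x∈ = [ id , (λ x∈bs → contradiction x∈ (bs∉ x∈bs)) ]′
              (split-∈⁻ s (range1⁺ (All.lookup (bounds i) (∈-++⁺ˡ x∈))))
    w⊆ : ∀ {x} → x ∈ w′ → x ∈ bs
    w⊆ x∈ = [ (λ x∈as → contradiction x∈ (disjoint-++ v′ (distinct i) (as⊆ x∈as))) , id ]′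
              (split-∈⁻ s (range1⁺ (All.lookup (bounds i) (∈-++⁺ʳ v′ x∈))))
    k≡ : k′ ≡ k
    k≡ = trans (sym (split-lengthˡ s)) (trans (≤-antisym
           (unique-⊆⇒length≤ (increasing⇒unique (proj₁ (split-increasing (increasing-range1 N) s))) as⊆)
           (unique-⊆⇒length≤ uv v⊆)) lv)
    lw : length w′ ≡ l
    lw = +-cancelˡ-≡ k _ l (trans (cong (_+ length w′) (sym lv)) (trans (sym (length-++ v′)) (len i)))
    build : k′ ≡ k → Split k′ (range1 N) as bs → ∃ λ x → Source x × Relabels x (v′ , w′)
    build refl s with relabel-onto (proj₁ (incs s)) (split-lengthˡ s) uv lv v⊆
                    | relabel-onto (proj₂ (incs s)) (lengthʳ s) uw lw w⊆
    ... | v , iv , refl | w , iw , refl =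
      ((as , bs) , (v , w)) ,
      (s , (iv , unrelabelled invP v (relabel-orderPreserving (proj₁ (incs s)) (split-lengthˡ s) iv) pv)
         , (iw , unrelabelled invQ w (relabel-orderPreserving (proj₂ (incs s)) (lengthʳ s) iw) qw)) , refl , refl
  -- The relabelled word shows its letter set, whose sorted list is `as`; then relabelling along
  -- `as` can be undone.
  same : ∀ {as bs v w k} → Increasing as → Increasing bs → length as ≡ k → length bs ≡ k → IsPerm k v → IsPerm k w →
         map (app as) v ≡ map (app bs) w → as ≡ bs × v ≡ w
  same {as} {bs} {v} {w} ia ib la lb iv iw eq = finish as≡bs
    where
    as≡bs : as ≡ bs
    as≡bs = increasing-≡ ia ib (λ x∈ → relabel-⊆ ib lb iw (subst (_ ∈_) eq (relabel-⊇ ia la iv x∈)))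
                               (λ x∈ → relabel-⊆ ia la iv (subst (_ ∈_) (sym eq) (relabel-⊇ ib lb iw x∈)))
    finish : as ≡ bs → as ≡ bs × v ≡ w
    finish refl = refl , relabel-injective ia la iv iw eq
  injective : ∀ {x x′ y} → Source x → Source x′ → Target y → Relabels x y → Relabels x′ y → x ≡ x′
  injective (s , (iv , _) , (iw , _)) (s′ , (iv′ , _) , (iw′ , _)) _ (refl , refl) (eq₁ , eq₂)
    with same (proj₁ (incs s)) (proj₁ (incs s′)) (split-lengthˡ s) (split-lengthˡ s′) iv iv′ eq₁
       | same (proj₂ (incs s)) (proj₂ (incs s′)) (lengthʳ s) (lengthʳ s′) iw iw′ eq₂
  ... | refl , refl | refl , refl = refl

-- The pairs are layered by the length `suc (j + j)` of the first word. The hypothesis `odd` puts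
-- every pair into a layer, and the total length then fixes the length of the second word.
card-pairs : ∀ {P} n → OrderInvariant P → (∀ {w} → P w → ∃ λ j → length w ≡ suc (j + j)) →
  (∀ j → Card (λ w → IsPerm (suc (j + j)) w × P w) (EC j)) →
  Card (λ (v , w) → IsPerm (2 * n) (v ++ w) × P v × P w) (ECsum n)
card-pairs {P} n inv odd cards = card-⇔ (λ (_ , _ , i , _ , p , q) → i , p , q) grow
  (card-∃< n (λ (_ , l , _) (_ , l′ , _) → double-injective (suc-injective (trans (sym l) l′))) layer)
  where
  Layer : ℕ → ℕ → List ℕ × List ℕ → Set
  Layer N j (v , w) = IsPerm N (v ++ w) × length v ≡ suc (j + j) × P v × P w
  count : ℕ → ℕ
  count j = ((2 * n) C (2 * j + 1)) * EC j * EC (n ∸ 1 ∸ j)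
  2j+1 : ∀ j → 2 * j + 1 ≡ suc (j + j)
  2j+1 = solve-∀
  sum≡ : ∀ j d → suc (j + j) + suc (d + d) ≡ 2 * suc (j + d)
  sum≡ = solve-∀
  -- Here `d` stands for `n ∸ 1 ∸ j`; the equation keeps truncated subtraction out of the
  -- arithmetic.
  layer′ : ∀ j d → n ≡ suc (j + d) → Card (Layer (2 * n) j) (count j)
  layer′ j d eq = subst (Card _) count≡
    (subst (λ N → Card (Layer N j) ((N C suc (j + j)) * (EC j * EC d))) (trans (sum≡ j d) (cong (2 *_) (sym eq)))
      (card-concat inv inv (cards j) (cards d)))
    where
    count≡ : ((2 * n) C suc (j + j)) * (EC j * EC d) ≡ count j
    count≡ = trans (sym (*-assoc ((2 * n) C suc (j + j)) (EC j) (EC d)))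
      (cong₂ (λ a d → ((2 * n) C a) * EC j * EC d) (sym (2j+1 j))
         (sym (trans (cong (λ z → z ∸ 1 ∸ j) eq) (m+n∸m≡n j d))))
  layer : ∀ {j} → j < n → Card (Layer (2 * n) j) (count j)
  layer {j} j<n = layer′ j (n ∸ suc j) (sym (m+[n∸m]≡n j<n))
  grow : ∀ {x} → _ → ∃ λ j → j < n × Layer (2 * n) j x
  grow {v , w} (i , p , q) with odd p | odd q
  ... | j , lv | d , lw = j , j<n , i , lv , p , q
    where
    n≡ : suc (j + d) ≡ n
    n≡ = *-cancelˡ-≡ (suc (j + d)) n 2 (trans (sym (sum≡ j d)) (trans (sym (cong₂ _+_ lv lw)) (trans (sym (length-++ v)) (len i))))
    j<n : j < n
    j<n = subst (j <_) n≡ (s≤s (m≤m+n j d))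

T-∧⁻ : ∀ {x y} → T (x ∧ y) → T x × T y
T-∧⁻ = Equivalence.to T-∧

T-∧⁺ : ∀ {x y} → T x → T y → T (x ∧ y)
T-∧⁺ p q = Equivalence.from T-∧ (p , q)

allᵇ⁻ : ∀ {A : Set} {q : A → Bool} xs → T (allᵇ q xs) → ∀ {x} → x ∈ xs → T (q x)
allᵇ⁻ (x ∷ xs) t (here refl) = proj₁ (T-∧⁻ t)
allᵇ⁻ (x ∷ xs) t (there x∈)  = allᵇ⁻ xs (proj₂ (T-∧⁻ t)) x∈

allᵇ⁺ : ∀ {A : Set} {q : A → Bool} xs → (∀ {x} → x ∈ xs → T (q x)) → T (allᵇ q xs)
allᵇ⁺ []       f = _
allᵇ⁺ (x ∷ xs) f = T-∧⁺ (f (here refl)) (allᵇ⁺ xs (f ∘ there))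

-- Ballot permutations

-- The start height `h` is arbitrary so that the condition on prefixes can be passed on past the
-- first step. From height 0 a first down-step already violates it.
prefixes⇒path : ∀ {h e} s → (∀ {k} → k ≤ length s → downs (take k s) ≤ h + ups (take k s)) →
                h + ups s ≡ e + downs s → Path h s e
prefixes⇒path {h} {e} [] _ eq with refl ← +-cancelʳ-≡ 0 h e eq = stop
prefixes⇒path {h} (true ∷ s) f eq =
  up (prefixes⇒path s (λ {k} k≤ → subst (downs (take k s) ≤_) (+-suc h _) (f (s≤s k≤))) (trans (sym (+-suc h _)) eq))
prefixes⇒path {zero} (false ∷ s) f eq with () ← f (s≤s (z≤n {length s}))
prefixes⇒path {suc h} {e} (false ∷ s) f eq =
  down (prefixes⇒path s (λ k≤ → s≤s⁻¹ (f (s≤s k≤))) (suc-injective (trans eq (+-suc e _))))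

path⇒prefixes : ∀ {h e s} → Path h s e → ∀ k → downs (take k s) ≤ h + ups (take k s)
path⇒prefixes π        zero    = z≤n
path⇒prefixes stop     (suc k) = z≤n
path⇒prefixes {h} (up {s = s} π) (suc k) = subst (downs (take k s) ≤_) (sym (+-suc h _)) (path⇒prefixes π k)
path⇒prefixes (down π) (suc k) = s≤s (path⇒prefixes π k)

module _ {w : List ℕ} (u : Unique w) where

  prefix-downs : ∀ k → countᵇ isDes (take k (adjPairs w)) ≡ downs (take k (steps w))
  prefix-downs k = trans (countᵇ-isDes (take k (adjPairs w)))
    (cong downs (trans (sym (take-map k (adjPairs w))) (cong (take k) (steps≡isUp w))))

  prefix-ups : ∀ k → countᵇ isAsc (take k (adjPairs w)) ≡ ups (take k (steps w))
  prefix-ups k = trans (countᵇ-isAsc (Allₚ.take⁺ k (adjPairs-distinct u)))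
    (cong ups (trans (sym (take-map k (adjPairs w))) (cong (take k) (steps≡isUp w))))

  length-steps : length (steps w) ≡ length w ∸ 1
  length-steps = go w
    where
    go : ∀ w → length (steps w) ≡ length w ∸ 1
    go []       = refl
    go (x ∷ xs) = length-stepsFrom x xs

  ballot⇒path : ∀ {e} → T (ballot w) → ups (steps w) ≡ e + downs (steps w) → Path 0 (steps w) e
  ballot⇒path t = prefixes⇒path (steps w) prefix
    where
    prefix : ∀ {k} → k ≤ length (steps w) → downs (take k (steps w)) ≤ ups (take k (steps w))
    -- `ballot` tests prefixes of length at least 1 only; the empty one is trivial.
    prefix {zero}  _  = z≤n
    prefix {suc k} k≤ = subst₂ _≤_ (prefix-downs (suc k)) (prefix-ups (suc k))
      (≤ᵇ⇒≤ _ _ (allᵇ⁻ _ t (range1⁺ (s≤s z≤n , subst (suc k ≤_) length-steps k≤))))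

  path⇒ballot : ∀ {e} → Path 0 (steps w) e → T (ballot w)
  path⇒ballot π = allᵇ⁺ (range1 (length w ∸ 1)) λ {k} _ → ≤⇒≤ᵇ (subst₂ _≤_ (sym (prefix-downs k)) (sym (prefix-ups k)) (path⇒prefixes π k))

2*suc : ∀ i → 2 * suc i ≡ suc (suc (i + i))
2*suc i = cong suc (trans (+-suc i (i + 0)) (cong (λ z → suc (i + z)) (+-identityʳ i)))

steps-total′ : ∀ {i w} → IsPerm (2 * suc i) w → ups (steps w) + downs (steps w) ≡ suc (i + i)
steps-total′ {i} {w} isP = steps-total (subst (λ m → IsPerm m w) (2*suc i) isP)

-- There are 2i + 1 steps, so having `i` descents and ending at height 1 are equivalent: the
-- condition on descents is absorbed into the endpoint.
card-b : ∀ i → Card (λ w → IsPerm (2 * suc i) w × Path 0 (steps w) 1) (b (2 * suc i) i)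
card-b i = card-⇔ to from (card-perms-countᵇ (2 * suc i) (λ w → ballot w ∧ (des w ≡ᵇ i)))
  where
  to : ∀ {w} → IsPerm (2 * suc i) w × T (ballot w ∧ (des w ≡ᵇ i)) → IsPerm (2 * suc i) w × Path 0 (steps w) 1
  to {w} (isP , t) = isP , ballot⇒path (distinct isP) (proj₁ (T-∧⁻ t)) ups≡
    where
    downs≡ : downs (steps w) ≡ i
    downs≡ = trans (sym (des≡downs w)) (≡ᵇ⇒≡ (des w) i (proj₂ (T-∧⁻ {ballot w} t)))
    ups≡ : ups (steps w) ≡ 1 + downs (steps w)
    ups≡ = +-cancelʳ-≡ (downs (steps w)) (ups (steps w)) _
      (trans (steps-total′ {i} isP) (sym (cong (λ d → suc (d + d)) downs≡)))
  from : ∀ {w} → IsPerm (2 * suc i) w × Path 0 (steps w) 1 → IsPerm (2 * suc i) w × T (ballot w ∧ (des w ≡ᵇ i))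
  from {w} (isP , π) = isP , T-∧⁺ (path⇒ballot (distinct isP) π) (≡⇒≡ᵇ (des w) i (trans (des≡downs w) downs≡))
    where
    downs≡ : downs (steps w) ≡ i
    downs≡ = double-injective (suc-injective (trans (cong (_+ downs (steps w)) (sym (path-sum π))) (steps-total′ {i} isP)))

-- Ballot permutations and pairs of excursions

stepsFrom-cut′ : ∀ x xs s₁ {e s₂} → stepsFrom x xs ≡ s₁ ++ e ∷ s₂ →
  ∃₂ λ as y → ∃ λ bs → xs ≡ as ++ y ∷ bs × stepsFrom x as ≡ s₁ × (last (x ∷ as) ≤ᵇ y) ≡ e × stepsFrom y bs ≡ s₂
stepsFrom-cut′ x (y ∷ ys) []       eq = [] , y , ys , refl , refl , ∷-injectiveˡ eq , ∷-injectiveʳ eq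
stepsFrom-cut′ x (y ∷ ys) (_ ∷ s₁) eq with stepsFrom-cut′ y ys s₁ (∷-injectiveʳ eq)
... | as , z , bs , refl , e₁ , e₂ , e₃ = y ∷ as , z , bs , refl , cong₂ _∷_ (∷-injectiveˡ eq) e₁ , e₂ , e₃
stepsFrom-cut′ x [] []      ()
stepsFrom-cut′ x [] (_ ∷ _) ()

ExcursionPair : ℕ → List ℕ × List ℕ → Set
ExcursionPair N (v , w) = IsPerm N (v ++ w) × Excursion v × Excursion w

-- Weak on both sides, so that `≤-total` covers all pairs; distinct letters rule out the overlap.
JoinUp JoinDown : List ℕ × List ℕ → Set
JoinUp   (v , w) = last v ≤ first w
JoinDown (v , w) = first w ≤ last v

≤ᵇ≡true⇒≤ : ∀ {x y} → (x ≤ᵇ y) ≡ true → x ≤ y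
≤ᵇ≡true⇒≤ {x} {y} eq = ≤ᵇ⇒≤ x y (subst T (sym eq) _)

-- The cut is unique: with a nonempty `es` between two cuts, `v` is followed by an up-step and then
-- by the steps of `es`, which end the excursion `v ++ es` but also begin the excursion `es ++ w`.
-- `no-up-rotation` forbids this.
excursion-extend-≡ : ∀ v es w → Excursion v → Excursion (v ++ es) → Excursion (es ++ w) → Excursion w →
                     JoinUp (v , es ++ w) → (v , es ++ w) ≡ (v ++ es , w)
excursion-extend-≡ v [] w _ _ _ _ _ = cong (_, w) (sym (++-identityʳ v))
excursion-extend-≡ (x ∷ v) (y ∷ es) (z ∷ w) _ π ρ _ j = ⊥-elim (no-up-rotation
  (subst (λ s → Path 0 s 0) (trans (steps-++ x v y es) (cong (λ e → stepsFrom x v ++ e ∷ stepsFrom y es) (≤ᵇ-true j))) π)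
  (subst (λ s → Path 0 s 0) (steps-++ y es z w) ρ))

excursion-up-split : ∀ {v w v′ w′} → v ++ w ≡ v′ ++ w′ → Excursion v → Excursion w → Excursion v′ → Excursion w′ →
                     JoinUp (v , w) → JoinUp (v′ , w′) → (v , w) ≡ (v′ , w′)
excursion-up-split {v} {w} {v′} {w′} eq πv πw πv′ πw′ j j′ with ++-cases v v′ eq
... | inj₁ (es , refl , refl) = excursion-extend-≡ v es w′ πv πv′ πw πw′ j
... | inj₂ (es , refl , refl) = sym (excursion-extend-≡ v′ es w πv′ πv πw′ πw j′)

card-upPairs : ∀ {N n} → Card (λ w → IsPerm N w × Path 0 (steps w) 1) n →
               Card (λ x → ExcursionPair N x × JoinUp x) n
card-upPairs {N} = card-bij (λ u (v , w) → u ≡ v ++ w) total onto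
  (λ { _ ((_ , a , b) , j) ((_ , a′ , b′) , j′) refl eq → excursion-up-split eq a b a′ b′ j j′ })
  (λ { _ _ _ refl refl → refl })
  where
  total : ∀ {u} → IsPerm N u × Path 0 (steps u) 1 →
          ∃ λ x → (ExcursionPair N x × JoinUp x) × u ≡ proj₁ x ++ proj₂ x
  total {x ∷ xs} (i , π) with lastUp₀ π
  ... | s₁ , s₂ , eq , ρ , σ with stepsFrom-cut′ x xs s₁ eq
  ... | as , y , bs , refl , refl , e , refl = (x ∷ as , y ∷ bs) , ((i , ρ , σ) , ≤ᵇ≡true⇒≤ e) , refl
  onto : ∀ {x} → ExcursionPair N x × JoinUp x →
         ∃ λ u → (IsPerm N u × Path 0 (steps u) 1) × u ≡ proj₁ x ++ proj₂ x
  onto {x ∷ v , y ∷ w} ((i , π , ρ) , j) = (x ∷ v) ++ y ∷ w ,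
    (i , subst (λ s → Path 0 s 1) (sym (trans (steps-++ x v y w) (cong (λ e → stepsFrom x v ++ e ∷ stepsFrom y w) (≤ᵇ-true j))))
           (path-++ π (up (path-lift ρ)))) , refl

card-downPairs : ∀ {N n} → Card (λ x → ExcursionPair N x × JoinUp x) n →
                 Card (λ x → ExcursionPair N x × JoinDown x) n
card-downPairs {N} = card-bij (λ (v , w) (v′ , w′) → v′ ≡ reverse w × w′ ≡ reverse v)
  (λ { {v , w} (p , j) → (reverse w , reverse v) ,
       (rev p , subst₂ _≤_ (sym (first-reverse v)) (sym (last-reverse w)) j) , refl , refl })
  (λ { {v , w} (p , j) → (reverse w , reverse v) ,
       (rev p , subst₂ _≤_ (sym (last-reverse w)) (sym (first-reverse v)) j) ,
       sym (reverse-involutive v) , sym (reverse-involutive w) })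
  (λ { _ _ _ (refl , refl) (refl , refl) → refl })
  (λ { _ _ _ (refl , refl) (eq₁ , eq₂) → cong₂ _,_ (reverse-injective eq₂) (reverse-injective eq₁) })
  where
  rev : ∀ {v w} → ExcursionPair N (v , w) → ExcursionPair N (reverse w , reverse v)
  rev {v} {w} (i , π , ρ) = let uv , uw = unique-++⁻ v (distinct i) in
    subst (IsPerm N) (reverse-++ v w) (isPerm-reverse i) , excursion-reverse uw ρ , excursion-reverse uv π

card-excursionPairs : ∀ i → Card (ExcursionPair (2 * suc i)) (b (2 * suc i) i + b (2 * suc i) i)
card-excursionPairs i = card-⇔ [ proj₁ , proj₁ ]′
  (λ { {v , w} p → Sum.map (p ,_) (p ,_) (≤-total (last v) (first w)) })
  (card-⊎ disjoint ups₁ (card-downPairs ups₁))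
  where
  ups₁ = card-upPairs (card-b i)
  disjoint : ∀ {x} → ExcursionPair _ x × JoinUp x → ExcursionPair _ x × JoinDown x → ⊥
  disjoint {x ∷ v , y ∷ w} ((isP , _) , j) (_ , j′) =
    disjoint-++ (x ∷ v) (distinct isP) (last∈ x v) (here (≤-antisym j j′))

excursion-invariant : OrderInvariant Excursion
excursion-invariant = record { relabelled = excursion-map ; unrelabelled = excursion-unmap }

excursion-odd : ∀ {w} → Excursion w → ∃ λ j → length w ≡ suc (j + j)
excursion-odd {x ∷ xs} π = downs s ,
  cong suc (trans (sym (length-stepsFrom x xs)) (trans (sym (ups+downs s)) (cong (_+ downs s) (path-sum π))))
  where s = stepsFrom x xs

-- Pairs of excursions counted twice: by the direction of the join and by the length of the first
-- word.
2b≡ECsum : ∀ i → b (2 * suc i) i + b (2 * suc i) i ≡ ECsum (suc i)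
2b≡ECsum i = card-unique (card-excursionPairs i)
  (card-pairs (suc i) excursion-invariant excursion-odd (λ j → card-excursion (card-minFirstBalanced j)))

-- Cycles of a permutation

rotate₁ : List ℕ → List ℕ
rotate₁ []       = []
rotate₁ (x ∷ xs) = xs ++ x ∷ []

-- The single equation `follows` states that each entry is sent to its cyclic successor, the last
-- one to the first; it is inherited by rotations.
record IsCycle (w c : List ℕ) : Set where
  constructor isCycle
  field
    nonrepeating : Unique c
    inside       : All (_∈[1, length w ]) c
    follows      : map (app w) c ≡ rotate₁ c

open IsCycle

follows-rotate₁ : ∀ (f : ℕ → ℕ) x xs → map f (x ∷ xs) ≡ xs ++ x ∷ [] → map f (xs ++ x ∷ []) ≡ rotate₁ (xs ++ x ∷ [])
follows-rotate₁ f x []       eq = eq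
follows-rotate₁ f x (y ∷ ys) eq = begin
  map f (y ∷ ys ++ x ∷ [])         ≡⟨ map-++ f (y ∷ ys) (x ∷ []) ⟩
  map f (y ∷ ys) ++ f x ∷ []       ≡⟨ cong₂ (λ l z → l ++ z ∷ []) (∷-injectiveʳ eq) (∷-injectiveˡ eq) ⟩
  (ys ++ x ∷ []) ++ y ∷ []         ∎
  where open ≡-Reasoning

follows-rot : ∀ (f : ℕ → ℕ) as bs → map f (as ++ bs) ≡ rotate₁ (as ++ bs) → map f (bs ++ as) ≡ rotate₁ (bs ++ as)
follows-rot f []       bs eq = subst (λ l → map f l ≡ rotate₁ l) (sym (++-identityʳ bs)) eq
follows-rot f (a ∷ as) bs eq = subst (λ l → map f l ≡ rotate₁ l) (++-assoc bs (a ∷ []) as)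
  (follows-rot f as (bs ++ a ∷ []) (subst (λ l → map f l ≡ rotate₁ l) (++-assoc as bs (a ∷ [])) (follows-rotate₁ f a (as ++ bs) eq)))

unique-rot : ∀ {as bs : List ℕ} → Unique (as ++ bs) → Unique (bs ++ as)
unique-rot {as} {bs} u = let ua , ub = unique-++⁻ as u in
  Uniq.++⁺ ub ua (λ (x∈b , x∈a) → disjoint-++ as u x∈a x∈b)

isCycle-rot : ∀ {w} as bs → IsCycle w (as ++ bs) → IsCycle w (bs ++ as)
isCycle-rot as bs (isCycle u i f) =
  isCycle (unique-rot {as} u) (Allₚ.++⁺ (Allₚ.++⁻ʳ as i) (Allₚ.++⁻ˡ as i)) (follows-rot _ as bs f)

-- Stated for a walk that has reached `c`, with `ys` still to come before the return to `i`. Since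
-- `i` is not in `ys`, the stopping test first succeeds at the end of `ys`.
orbitFrom-follows : ∀ {w i} c ys {f} → map (app w) (c ∷ ys) ≡ ys ++ i ∷ [] → i ∉ ys → length (c ∷ ys) ≤ f →
                    orbitFrom w i f c ≡ c ∷ ys
orbitFrom-follows {w} {i} c [] {suc f} eq i∉ _ with app w c ≡ᵇ i in e
... | true  = refl
... | false = ⊥-elim (subst T e (≡⇒≡ᵇ (app w c) i (∷-injectiveˡ eq)))
orbitFrom-follows {w} {i} c (y ∷ ys) {suc f} eq i∉ (s≤s len≤) with refl ← ∷-injectiveˡ eq with app w c ≡ᵇ i in e
... | true  = contradiction (here (sym (≡ᵇ⇒≡ (app w c) i (subst T (sym e) _)))) i∉
... | false = cong (c ∷_) (orbitFrom-follows (app w c) ys (∷-injectiveʳ eq) (i∉ ∘ there) len≤)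

unique-inside-length : ∀ {m c} → Unique c → All (_∈[1, m ]) c → length c ≤ m
unique-inside-length {m} u i = subst (_ ≤_) (length-range1 m) (unique-⊆⇒length≤ u (range1⁺ ∘ All.lookup i))

orbit-isCycle≡ : ∀ {w x xs} → IsCycle w (x ∷ xs) → orbit w x ≡ x ∷ xs
orbit-isCycle≡ (isCycle u i f) = orbitFrom-follows _ _ f (unique⇒∉ u) (unique-inside-length u i)

-- Rotating the cycle to start at `x` turns it into the orbit of `x`.
orbit-∈ : ∀ {w c x y} → IsCycle w c → x ∈ c → y ∈ c → y ∈ orbit w x
orbit-∈ cyc x∈ y∈ with ∈-∃++ x∈
... | as , bs , refl = subst (_ ∈_) (sym (orbit-isCycle≡ (isCycle-rot as (_ ∷ bs) cyc)))
                         ([ ∈-++⁺ʳ (_ ∷ bs) , ∈-++⁺ˡ ]′ (∈-++⁻ as y∈))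

orbit-∈⁻ : ∀ {w c x y} → IsCycle w c → x ∈ c → y ∈ orbit w x → y ∈ c
orbit-∈⁻ cyc x∈ y∈ with ∈-∃++ x∈
... | as , bs , refl = [ ∈-++⁺ʳ as , ∈-++⁺ˡ ]′ (∈-++⁻ (_ ∷ bs) (subst (_ ∈_) (orbit-isCycle≡ (isCycle-rot as (_ ∷ bs) cyc)) y∈))

module _ {N : ℕ} {w : List ℕ} (isP : IsPerm N w) where

  private
    widen : ∀ {x} → x ∈[1, N ] → x ∈[1, length w ]
    widen {x} = subst (x ∈[1,_]) (sym (len isP))

  app-inside : ∀ {x} → x ∈[1, N ] → app w x ∈[1, N ]
  app-inside x∈ = All.lookup (bounds isP) (app-∈ (widen x∈))

  private
    -- vs is the part of the orbit of i traversed before c.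
    orbitFrom-isCycle : ∀ {i} f vs c → i ∷ map (app w) vs ≡ vs ++ c ∷ [] → Unique (vs ++ c ∷ []) →
      All (_∈[1, N ]) (vs ++ c ∷ []) → length vs + f ≡ N → IsCycle w (vs ++ orbitFrom w i f c)
    -- The fuel cannot be spent: `vs` and `c` would be N + 1 distinct letters among 1 to N.
    orbitFrom-isCycle zero vs c eq u ins l = contradiction (unique-inside-length u ins)
      (<⇒≱ (≤-reflexive (trans (cong suc (trans (sym l) (+-identityʳ _))) (sym (trans (length-++ vs) (+-comm _ 1))))))
    orbitFrom-isCycle {i} (suc f) vs c eq u ins l with app w c ≡ᵇ i in e
    ... | true = isCycle u (All.map widen ins) (begin
        map (app w) (vs ++ c ∷ [])     ≡⟨ map-++ (app w) vs (c ∷ []) ⟩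
        map (app w) vs ++ app w c ∷ [] ≡⟨ cong (λ z → map (app w) vs ++ z ∷ []) (≡ᵇ⇒≡ (app w c) i (subst T (sym e) _)) ⟩
        rotate₁ (i ∷ map (app w) vs)   ≡⟨ cong rotate₁ eq ⟩
        rotate₁ (vs ++ c ∷ [])         ∎)
      where open ≡-Reasoning
    ... | false = subst (IsCycle w) (++-assoc vs (c ∷ []) _)
        (orbitFrom-isCycle f (vs ++ c ∷ []) (app w c)
          (trans (cong (i ∷_) (map-++ (app w) vs (c ∷ []))) (cong (_++ app w c ∷ []) eq))
          (Uniq.++⁺ u ([] ∷ []) λ { (x∈ , here refl) → fresh x∈ })
          (Allₚ.++⁺ ins (app-inside c∈ ∷ []))
          (trans (cong (_+ f) (trans (length-++ vs) (+-comm _ 1))) (trans (sym (+-suc _ f)) l)))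
      where
      c∈ : c ∈[1, N ]
      c∈ = All.lookup ins (∈-++⁺ʳ vs (here refl))
      -- The next letter is not `i` by the failed test; if it were the image of an earlier `y`,
      -- injectivity would give `c` equal to `y`.
      fresh : app w c ∉ vs ++ c ∷ []
      fresh σc∈ with subst (app w c ∈_) (sym eq) σc∈
      ... | here σc≡i = subst T e (≡⇒≡ᵇ (app w c) i σc≡i)
      ... | there σc∈′ with ∈-map⁻ (app w) σc∈′
      ... | y , y∈ , σc≡σy = disjoint-++ vs u y∈
        (here (sym (app-injective (distinct isP) (widen c∈) (widen (All.lookup ins (∈-++⁺ˡ y∈))) σc≡σy)))

  orbit-isCycle : ∀ {i} → i ∈[1, N ] → IsCycle w (orbit w i)
  orbit-isCycle {i} i∈ = orbitFrom-isCycle (length w) [] i refl ([] ∷ []) (i∈ ∷ []) (len isP)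

  first-orbit : ∀ {i} → i ∈[1, N ] → first (orbit w i) ≡ i
  first-orbit i∈ = go w (widen i∈)
    where
    go : ∀ {i} v → i ∈[1, length v ] → first (orbit v i) ≡ i
    go []      (s≤s _ , ())
    go (_ ∷ _) _ = refl

  self∈orbit : ∀ {i} → i ∈[1, N ] → i ∈ orbit w i
  self∈orbit {i} i∈ with orbit w i in eq | first-orbit i∈
  ... | []    | refl with () ← proj₁ i∈
  ... | _ ∷ _ | refl = here refl

minimum : ∀ x xs → ∃ λ m → m ∈ x ∷ xs × All (m ≤_) (x ∷ xs)
minimum x [] = x , here refl , ≤-refl ∷ []
minimum x (y ∷ ys) with minimum y ys
... | m , m∈ , m≤ with ≤-total x m
...   | inj₁ x≤m = x , here refl , ≤-refl ∷ All.map (≤-trans x≤m) m≤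
...   | inj₂ m≤x = m , there m∈ , m≤x ∷ m≤

-- The starting letters used in `cycles`: `cycles w` is by definition `map (orbit w) (minima w)`.
minima : List ℕ → List ℕ
minima w = filterᵇ (λ i → allᵇ (i ≤ᵇ_) (orbit w i)) (range1 (length w))

minima⁻ : ∀ {w i} → i ∈ minima w → i ∈[1, length w ] × All (i ≤_) (orbit w i)
minima⁻ {w} {i} i∈ with ∈-filter⁻ (λ i → T? (allᵇ (i ≤ᵇ_) (orbit w i))) {xs = range1 (length w)} i∈
... | i∈r , t = range1⁻ i∈r , All.tabulate (λ {y} y∈ → ≤ᵇ⇒≤ i y (allᵇ⁻ (orbit w i) t y∈))

minima⁺ : ∀ {w i} → i ∈[1, length w ] → All (i ≤_) (orbit w i) → i ∈ minima w
minima⁺ {w} {i} i∈ i≤ = ∈-filter⁺ (λ i → T? (allᵇ (i ≤ᵇ_) (orbit w i))) (range1⁺ i∈)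
  (allᵇ⁺ (orbit w i) (λ y∈ → ≤⇒≤ᵇ (All.lookup i≤ y∈)))

increasing-minima : ∀ w → Increasing (minima w)
increasing-minima w = AllPairsₚ.filter⁺ (λ i → T? (allᵇ (i ≤ᵇ_) (orbit w i))) (increasing-range1 (length w))

allPairs-tabulate : ∀ {A : Set} {R : A → A → Set} {xs} → Unique xs →
                    (∀ {x y} → x ∈ xs → y ∈ xs → x ≢ y → R x y) → AllPairs R xs
allPairs-tabulate []       f = []
allPairs-tabulate (x≢ ∷ u) f =
  All.tabulate (λ y∈ → f (here refl) (there y∈) (All.lookup x≢ y∈)) ∷ allPairs-tabulate u (λ x∈ y∈ → f (there x∈) (there y∈))

module _ {N : ℕ} {w : List ℕ} (isP : IsPerm N w) where

  private
    narrow : ∀ {x} → x ∈[1, length w ] → x ∈[1, N ]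
    narrow {x} = subst (x ∈[1,_]) (len isP)

  minima-cover : ∀ {x} → x ∈[1, N ] → ∃ λ m → m ∈ minima w × x ∈ orbit w m
  minima-cover {x} x∈ with orbit w x | orbit-isCycle isP x∈ | self∈orbit isP x∈
  ... | y ∷ ys | cyc | x∈c with minimum y ys
  ... | m , m∈ , m≤ = m , minima⁺ (All.lookup (inside cyc) m∈) (All.tabulate (All.lookup m≤ ∘ orbit-∈⁻ cyc m∈)) ,
                      orbit-∈ cyc m∈ x∈c

  cycles-isCycle : ∀ {c} → c ∈ cycles w → IsCycle w c × All (first c ≤_) c
  cycles-isCycle c∈ with ∈-map⁻ (orbit w) c∈
  ... | i , i∈ , refl = let i∈r , i≤ = minima⁻ i∈ in
    orbit-isCycle isP (narrow i∈r) , subst (λ z → All (z ≤_) (orbit w i)) (sym (first-orbit isP (narrow i∈r))) i≤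

  private
    -- A common letter puts each minimum into the orbit of the other, so they bound each other and
    -- agree.
    orbits-disjoint : ∀ {i j} → i ∈ minima w → j ∈ minima w → i ≢ j → Disjoint (orbit w i) (orbit w j)
    orbits-disjoint i∈ j∈ i≢j (y∈i , y∈j) =
      let i∈r , i≤ = minima⁻ i∈
          j∈r , j≤ = minima⁻ j∈
          ci = orbit-isCycle isP (narrow i∈r)
          cj = orbit-isCycle isP (narrow j∈r)
          i∈y = orbit-∈ ci y∈i (self∈orbit isP (narrow i∈r))
          j∈y = orbit-∈ cj y∈j (self∈orbit isP (narrow j∈r))
      in i≢j (≤-antisym (All.lookup i≤ (orbit-∈⁻ ci y∈i j∈y)) (All.lookup j≤ (orbit-∈⁻ cj y∈j i∈y)))

  -- Turns the cycle decomposition into a word on all letters: cycle lengths add up to `N`, and two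
  -- cycles form a pair of the kind counted by `card-pairs`.
  concat-cycles : IsPerm N (concat (cycles w))
  concat-cycles = isPerm (≤-antisym (unique-inside-length u ins) full) u ins
    where
    u : Unique (concat (cycles w))
    u = Uniq.concat⁺ (All.tabulate (nonrepeating ∘ proj₁ ∘ cycles-isCycle))
          (AllPairsₚ.map⁺ (allPairs-tabulate (increasing⇒unique (increasing-minima w)) orbits-disjoint))
    ins : All (_∈[1, N ]) (concat (cycles w))
    ins = All.tabulate λ x∈ → let c , x∈c , c∈ = ∈-concat⁻′ (cycles w) x∈ in
            narrow (All.lookup (inside (proj₁ (cycles-isCycle c∈))) x∈c)
    full : N ≤ length (concat (cycles w))
    full = subst (_≤ length (concat (cycles w))) (length-range1 N) (unique-⊆⇒length≤ (unique-range1 N)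
      λ x∈ → let m , m∈ , x∈o = minima-cover (range1⁻ x∈) in ∈-concat⁺′ x∈o (∈-map⁺ (orbit w) m∈))

app-ext : ∀ {v w} → length v ≡ length w → (∀ {i} → i ∈[1, length v ] → app v i ≡ app w i) → v ≡ w
app-ext {[]}    {[]}    _  _ = refl
app-ext {x ∷ v} {y ∷ w} eq f = cong₂ _∷_ (f (≤-refl , s≤s z≤n)) (app-ext (suc-injective eq) tails)
  where
  tails : ∀ {i} → i ∈[1, length v ] → app v i ≡ app w i
  tails {suc i} (_ , i≤) = f (s≤s z≤n , s≤s i≤)

map-≡-lookup : ∀ {f g : ℕ → ℕ} {xs x} → map f xs ≡ map g xs → x ∈ xs → f x ≡ g x
map-≡-lookup eq (here refl) = ∷-injectiveˡ eq
map-≡-lookup eq (there x∈)  = map-≡-lookup (∷-injectiveʳ eq) x∈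

-- Every letter lies in some listed cycle, and `follows` for that cycle dictates its image.
cycles-injective : ∀ {N v w} → IsPerm N v → IsPerm N w → cycles v ≡ cycles w → v ≡ w
cycles-injective {N} {v} {w} iv iw eq = app-ext (trans (len iv) (sym (len iw))) agree
  where
  agree : ∀ {i} → i ∈[1, length v ] → app v i ≡ app w i
  agree {i} i∈ with ∈-concat⁻′ (cycles v) (perm-full (concat-cycles iv) (subst (i ∈[1,_]) (len iv) i∈))
  ... | c , i∈c , c∈ = map-≡-lookup
    (trans (follows (proj₁ (cycles-isCycle iv c∈))) (sym (follows (proj₁ (cycles-isCycle iw (subst (c ∈_) eq c∈)))))) i∈c

-- Cyclic ascents, cyclic descents and the maximal value of M

cycPairs-isUp : ∀ c → map isUp (cycPairs c) ≡ cyclicSteps c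
cycPairs-isUp []       = refl
cycPairs-isUp (x ∷ xs) = go x xs x
  where
  go : ∀ x xs z → map isUp (zip (x ∷ xs) (xs ++ z ∷ [])) ≡ stepsFrom x (xs ++ z ∷ [])
  go x []       z = refl
  go x (y ∷ ys) z = cong ((x ≤ᵇ y) ∷_) (go y ys z)

cA≡ups : ∀ c → cA c ≡ ups (cyclicSteps c)
cA≡ups c = trans (countᵇ≡ups _ isUp (All.universal (λ _ → refl) (cycPairs c))) (cong ups (cycPairs-isUp c))

cD≡downs : ∀ c → cD c ≡ downs (cyclicSteps c)
cD≡downs c = trans (countᵇ≡downs _ isUp (All.universal (λ (x , y) → <ᵇ≡not≤ᵇ x y) (cycPairs c))) (cong downs (cycPairs-isUp c))

cA+cD≡length : ∀ c → cA c + cD c ≡ length c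
cA+cD≡length c = trans (cong₂ _+_ (cA≡ups c) (cD≡downs c)) (trans (ups+downs (cyclicSteps c)) (length-cyclicSteps c))

isOdd-double : ∀ n → isOdd (n + n) ≡ false
isOdd-double zero    = refl
isOdd-double (suc n) = trans (cong (not ∘ isOdd) (+-suc n n)) (trans (not-involutive (isOdd (n + n))) (isOdd-double n))

isOdd-suc-double : ∀ n → T (isOdd (suc (n + n)))
isOdd-suc-double n = subst (T ∘ not) (sym (isOdd-double n)) _

-- An odd sum excludes `m` equal to `n`, so the larger exceeds the smaller by at least one.
odd-sum-⊓ : ∀ m n → T (isOdd (m + n)) → suc ((m ⊓ n) + (m ⊓ n)) ≤ m + n
odd-sum-⊓ m n odd with ≤-total m n
... | inj₁ m≤n rewrite m≤n⇒m⊓n≡m m≤n = +-monoʳ-< m (≤∧≢⇒< m≤n λ { refl → subst T (isOdd-double m) odd })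
... | inj₂ n≤m rewrite m≥n⇒m⊓n≡n n≤m = +-monoˡ-< n (≤∧≢⇒< n≤m λ { refl → subst T (isOdd-double n) odd })

sum≡suc-⊓ : ∀ m n → m + n ≡ suc ((m ⊓ n) + (m ⊓ n)) → m ≡ suc n ⊎ n ≡ suc m
sum≡suc-⊓ m n eq with ≤-total m n
... | inj₁ m≤n rewrite m≤n⇒m⊓n≡m m≤n = inj₂ (+-cancelˡ-≡ m n (suc m) (trans eq (sym (+-suc m m))))
... | inj₂ n≤m rewrite m≥n⇒m⊓n≡n n≤m = inj₁ (+-cancelʳ-≡ n m (suc n) eq)

suc-⊓≡sum : ∀ {m n} → m ≡ suc n ⊎ n ≡ suc m → m + n ≡ suc ((m ⊓ n) + (m ⊓ n))
suc-⊓≡sum {m} {n} (inj₁ refl) rewrite m≥n⇒m⊓n≡n (n≤1+n n) = refl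
suc-⊓≡sum {m} {n} (inj₂ refl) rewrite m≤n⇒m⊓n≡m (n≤1+n m) = +-suc m m

Mcyc-odd : ∀ c → T (isOdd (length c)) → suc (Mcyc c + Mcyc c) ≤ length c
Mcyc-odd c odd = subst (suc (Mcyc c + Mcyc c) ≤_) (cA+cD≡length c)
  (odd-sum-⊓ (cA c) (cD c) (subst (T ∘ isOdd) (sym (cA+cD≡length c)) odd))

Mcyc-max⇒balanced : ∀ c → length c ≡ suc (Mcyc c + Mcyc c) → AlmostBalanced (cyclicSteps c)
Mcyc-max⇒balanced c eq = subst₂ (λ u d → u ≡ suc d ⊎ d ≡ suc u) (cA≡ups c) (cD≡downs c)
  (sum≡suc-⊓ (cA c) (cD c) (trans (cA+cD≡length c) eq))

balanced⇒Mcyc-max : ∀ c → AlmostBalanced (cyclicSteps c) → length c ≡ suc (Mcyc c + Mcyc c)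
balanced⇒Mcyc-max c bal = trans (sym (cA+cD≡length c))
  (suc-⊓≡sum (subst₂ (λ u d → u ≡ suc d ⊎ d ≡ suc u) (sym (cA≡ups c)) (sym (cD≡downs c)) bal))

-- Each odd cycle has at least one letter beyond twice its M, so every further cycle costs a letter.
sum-Mcyc-bound : ∀ cs → All (T ∘ isOdd ∘ length) cs →
                 length cs + (sum (map Mcyc cs) + sum (map Mcyc cs)) ≤ length (concat cs)
sum-Mcyc-bound []       _            = z≤n
sum-Mcyc-bound (c ∷ cs) (odd ∷ odds) = begin
  suc (length cs) + ((Mcyc c + s) + (Mcyc c + s)) ≡⟨ regroup (length cs) (Mcyc c) s ⟩
  suc (Mcyc c + Mcyc c) + (length cs + (s + s))   ≤⟨ +-mono-≤ (Mcyc-odd c odd) (sum-Mcyc-bound cs odds) ⟩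
  length c + length (concat cs)                   ≡⟨ length-++ c ⟨
  length (c ++ concat cs)                         ∎
  where
  open ≤-Reasoning
  s = sum (map Mcyc cs)
  regroup : ∀ l m s → suc l + ((m + s) + (m + s)) ≡ suc (m + m) + (l + (s + s))
  regroup = solve-∀

≤-sum-tight : ∀ {a b x y} → a ≤ x → b ≤ y → x + y ≡ a + b → x ≡ a × y ≡ b
≤-sum-tight {a} {b} {x} {y} a≤x b≤y eq =
  ≤-antisym (+-cancelʳ-≤ b x a (≤-trans (+-monoʳ-≤ x b≤y) (≤-reflexive eq))) a≤x ,
  ≤-antisym (+-cancelˡ-≤ a y b (≤-trans (+-monoˡ-≤ y a≤x) (≤-reflexive eq))) b≤y

-- The bound leaves at most two cycles. No cycle would give no letters, and a single one would have
-- even length. For two cycles the bound is attained, hence attained by each.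
two-cycles : ∀ i cs → All (T ∘ isOdd ∘ length) cs → sum (map Mcyc cs) ≡ i → length (concat cs) ≡ suc (suc (i + i)) →
             ∃₂ λ c d → cs ≡ c ∷ d ∷ [] × AlmostBalanced (cyclicSteps c) × AlmostBalanced (cyclicSteps d)
two-cycles i [] _ _ ()
two-cycles i (c ∷ []) (odd ∷ []) _ eq =
  ⊥-elim (subst T (trans (not-involutive (isOdd (i + i))) (isOdd-double i))
    (subst (T ∘ isOdd) (trans (cong length (sym (++-identityʳ c))) eq) odd))
two-cycles i (c ∷ d ∷ []) (oc ∷ od ∷ []) refl eq = c , d , refl , Mcyc-max⇒balanced c (proj₁ tight) , Mcyc-max⇒balanced d (proj₂ tight)
  where
  regroup : ∀ m n → suc (suc ((m + (n + 0)) + (m + (n + 0)))) ≡ suc (m + m) + suc (n + n)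
  regroup = solve-∀
  tight = ≤-sum-tight (Mcyc-odd c oc) (Mcyc-odd d od)
    (trans (trans (cong (length c +_) (cong length (sym (++-identityʳ d)))) (sym (length-++ c)))
      (trans eq (regroup (Mcyc c) (Mcyc d))))
two-cycles i cs@(_ ∷ _ ∷ _ ∷ rest) odds refl eq = contradiction
  (≤-trans (sum-Mcyc-bound cs odds) (≤-reflexive eq))
  (<⇒≱ (s≤s (s≤s (s≤s (m≤n+m _ (length rest))))))

-- The permutation with two prescribed cycles

lookupBy : List ℕ → List ℕ → ℕ → ℕ
lookupBy (k ∷ ks) (v ∷ vs) z = if z ≡ᵇ k then v else lookupBy ks vs z
-- The default is never met in the permutation built below: its keys are all the letters 1 to `N`.
lookupBy _        _        z = 0

map-lookupBy : ∀ {ks vs} → Unique ks → length ks ≡ length vs → map (lookupBy ks vs) ks ≡ vs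
map-lookupBy {[]}     {[]}     _ _  = refl
map-lookupBy {k ∷ ks} {v ∷ vs} u@(_ ∷ u′) eq = cong₂ _∷_ same
  (trans (map-cong-local (All.tabulate other)) (map-lookupBy u′ (suc-injective eq)))
  where
  same : lookupBy (k ∷ ks) (v ∷ vs) k ≡ v
  same with k ≡ᵇ k | ≡⇒≡ᵇ k k refl
  ... | true | _ = refl
  other : ∀ {z} → z ∈ ks → lookupBy (k ∷ ks) (v ∷ vs) z ≡ lookupBy ks vs z
  other {z} z∈ with z ≡ᵇ k in e
  ... | true  = contradiction (subst (_∈ ks) (≡ᵇ⇒≡ z k (subst T (sym e) _)) z∈) (unique⇒∉ u)
  ... | false = refl

unique-map⇒injectiveOn : ∀ {f : ℕ → ℕ} {xs x y} → Unique (map f xs) → x ∈ xs → y ∈ xs → f x ≡ f y → x ≡ y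
unique-map⇒injectiveOn u (here refl) (here refl) _ = refl
unique-map⇒injectiveOn {f} {xs = _ ∷ xs} u (here refl) (there y∈) eq =
  contradiction (subst (_∈ map f xs) (sym eq) (∈-map⁺ f y∈)) (unique⇒∉ u)
unique-map⇒injectiveOn {f} {xs = _ ∷ xs} u (there x∈) (here refl) eq =
  contradiction (subst (_∈ map f xs) eq (∈-map⁺ f x∈)) (unique⇒∉ u)
unique-map⇒injectiveOn (_ ∷ u) (there x∈) (there y∈) eq = unique-map⇒injectiveOn u x∈ y∈ eq

app-applyUpTo : ∀ (f : ℕ → ℕ) {n i} → i < n → app (applyUpTo f n) (suc i) ≡ f i
app-applyUpTo f {suc n} {zero}  _         = refl
app-applyUpTo f {suc n} {suc i} (s≤s i<n) = app-applyUpTo (f ∘ suc) i<n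

rotate₁-rot : ∀ c → Rot c (rotate₁ c)
rotate₁-rot []       = rot-refl
rotate₁-rot (x ∷ xs) = rot (x ∷ []) xs

++-injective : ∀ {A : Set} (as bs : List A) {cs ds} → length as ≡ length bs → as ++ cs ≡ bs ++ ds → as ≡ bs × cs ≡ ds
++-injective []       []       _ eq = refl , eq
++-injective (a ∷ as) (b ∷ bs) l eq with refl ← ∷-injectiveˡ eq =
  let e₁ , e₂ = ++-injective as bs (suc-injective l) (∷-injectiveʳ eq) in cong (a ∷_) e₁ , e₂

module _ {N : ℕ} (c d : List ℕ) (isP : IsPerm N (c ++ d)) where

  private
    images : List ℕ
    images = rotate₁ c ++ rotate₁ d
    images↭ : c ++ d ↭ images
    images↭ = ++⁺ (rot⇒↭ (rotate₁-rot c)) (rot⇒↭ (rotate₁-rot d))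
    isP′ : IsPerm N images
    isP′ = isPerm-↭ images↭ isP
    σ : ℕ → ℕ
    σ = lookupBy (c ++ d) images
    map-σ : map σ (c ++ d) ≡ images
    map-σ = map-lookupBy (distinct isP) (trans (len isP) (sym (len isP′)))

  -- Sends each letter of `c` and of `d` to its cyclic successor. The images are `c` and `d` rotated
  -- separately, hence again all letters, each once.
  fromCycles : List ℕ
  fromCycles = applyUpTo (σ ∘ suc) N

  private
    app≡σ : ∀ {z} → z ∈ c ++ d → app fromCycles z ≡ σ z
    app≡σ {z} z∈ with z | All.lookup (bounds isP) z∈
    ... | suc _ | _ , z< = app-applyUpTo (σ ∘ suc) z<
    map-app : map (app fromCycles) c ++ map (app fromCycles) d ≡ images
    map-app = trans (sym (map-++ (app fromCycles) c d)) (trans (map-cong-local (All.tabulate app≡σ)) map-σ)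
    splitted : map (app fromCycles) c ≡ rotate₁ c × map (app fromCycles) d ≡ rotate₁ d
    splitted = ++-injective _ _ (trans (length-map _ c) (↭-length (rot⇒↭ (rotate₁-rot c)))) map-app
    full : ∀ {i} → i < N → suc i ∈ c ++ d
    full i< = perm-full isP (s≤s z≤n , i<)

  fromCycles-isPerm : IsPerm N fromCycles
  fromCycles-isPerm = isPerm (length-applyUpTo (σ ∘ suc) N)
    (Uniq.applyUpTo⁺₁ (σ ∘ suc) N λ i<j j<N eq → <⇒≢ i<j (suc-injective
      (unique-map⇒injectiveOn (subst Unique (sym map-σ) (distinct isP′)) (full (<-trans i<j j<N)) (full j<N) eq)))
    (Allₚ.applyUpTo⁺₁ (σ ∘ suc) N λ {i} i< →
      All.lookup (bounds isP′) (subst (σ (suc i) ∈_) map-σ (∈-map⁺ σ (full i<))))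

  private
    insides : All (_∈[1, length fromCycles ]) (c ++ d)
    insides = subst (λ m → All (_∈[1, m ]) (c ++ d)) (sym (len fromCycles-isPerm)) (bounds isP)
    cycleˡ : IsCycle fromCycles c
    cycleˡ = isCycle (proj₁ (unique-++⁻ c (distinct isP))) (Allₚ.++⁻ˡ c insides) (proj₁ splitted)
    cycleʳ : IsCycle fromCycles d
    cycleʳ = isCycle (proj₂ (unique-++⁻ c (distinct isP))) (Allₚ.++⁻ʳ c insides) (proj₂ splitted)

  -- `cycles` begins each cycle at its minimum and lists minima in increasing order, which is what
  -- the bounds and `x < y` provide.
  cycles-fromCycles : ∀ {x xs y ys} → c ≡ x ∷ xs → d ≡ y ∷ ys → All (x ≤_) c → All (y ≤_) d → x < y →
                      cycles fromCycles ≡ c ∷ d ∷ []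
  cycles-fromCycles {x} {_} {y} refl refl x≤ y≤ x<y = trans (cong (map (orbit fromCycles)) minima≡)
    (cong₂ (λ a b → a ∷ b ∷ []) (orbit-isCycle≡ cycleˡ) (orbit-isCycle≡ cycleʳ))
    where
    to : ∀ {z} → z ∈ minima fromCycles → z ∈ x ∷ y ∷ []
    to z∈ with minima⁻ z∈
    ... | z∈r , z≤ with ∈-++⁻ c (perm-full isP (subst (_ ∈[1,_]) (len fromCycles-isPerm) z∈r))
    ... | inj₁ z∈c = here (≤-antisym (All.lookup z≤ (orbit-∈ cycleˡ z∈c (here refl))) (All.lookup x≤ z∈c))
    ... | inj₂ z∈d = there (here (≤-antisym (All.lookup z≤ (orbit-∈ cycleʳ z∈d (here refl))) (All.lookup y≤ z∈d)))
    from : ∀ {z} → z ∈ x ∷ y ∷ [] → z ∈ minima fromCycles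
    from (here refl) = minima⁺ (All.lookup (inside cycleˡ) (here refl)) (subst (All (x ≤_)) (sym (orbit-isCycle≡ cycleˡ)) x≤)
    from (there (here refl)) = minima⁺ (All.lookup (inside cycleʳ) (here refl)) (subst (All (y ≤_)) (sym (orbit-isCycle≡ cycleʳ)) y≤)
    minima≡ : minima fromCycles ≡ x ∷ y ∷ []
    minima≡ = increasing-≡ (increasing-minima fromCycles) ((x<y ∷ []) ∷ [] ∷ []) to from

BalancedPair : ℕ → List ℕ × List ℕ → Set
BalancedPair N (c , d) = IsPerm N (c ++ d) × MinFirstBalanced c × MinFirstBalanced d

firsts-< : ∀ {N w c d} → IsPerm N w → cycles w ≡ c ∷ d ∷ [] → first c < first d
-- The facts about `minima w` are abstracted along with it, so that they survive when `eq`
-- determines the list.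
firsts-< {w = w} isP eq with minima w | increasing-minima w | (λ {i} → minima⁻ {w} {i})
firsts-< {w = w} isP refl | x ∷ y ∷ [] | (x<y ∷ []) ∷ _ | mins = subst₂ _<_ (sym (firstOrbit (here refl))) (sym (firstOrbit (there (here refl)))) x<y
  where
  firstOrbit : ∀ {i} → i ∈ x ∷ y ∷ [] → first (orbit w i) ≡ i
  firstOrbit i∈ = first-orbit isP (subst (_ ∈[1,_]) (len isP) (proj₁ (mins i∈)))

minFirstBalanced-odd : ∀ {w} → MinFirstBalanced w → ∃ λ j → length w ≡ suc (j + j)
minFirstBalanced-odd {w} (minFirstBalanced _ bal) = Mcyc w , balanced⇒Mcyc-max w bal

minFirstBalanced-invariant : OrderInvariant MinFirstBalanced
minFirstBalanced-invariant = record { relabelled = to ; unrelabelled = from }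
  where
  to : ∀ {f} w → OrderPreservingOn w f → MinFirstBalanced w → MinFirstBalanced (map f w)
  to [] op g = g
  to {f} w@(x ∷ xs) op (minFirstBalanced min bal) = minFirstBalanced
    (Allₚ.map⁺ (All.tabulate λ {y} y∈ → ≤ᵇ⇒≤ (f x) (f y) (subst T (sym (op (here refl) y∈)) (≤⇒≤ᵇ (All.lookup min y∈)))))
    (subst AlmostBalanced (sym (cyclicSteps-map w op)) bal)
  from : ∀ {f} w → OrderPreservingOn w f → MinFirstBalanced (map f w) → MinFirstBalanced w
  from [] op g = g
  from {f} w@(x ∷ xs) op (minFirstBalanced min bal) = minFirstBalanced
    (All.tabulate λ {y} y∈ → ≤ᵇ⇒≤ x y (subst T (op (here refl) y∈) (≤⇒≤ᵇ (All.lookup (Allₚ.map⁻ min) y∈))))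
    (subst AlmostBalanced (cyclicSteps-map w op) bal)

-- A permutation yields the order in which its cycles are listed, that of increasing minima, so only
-- half of the pairs are met.
card-orderedPairs : ∀ i → Card (λ x → BalancedPair (2 * suc i) x × first (proj₁ x) < first (proj₂ x)) (p (2 * suc i) i)
card-orderedPairs i = card-bij (λ w (c , d) → cycles w ≡ c ∷ d ∷ []) total onto
  (λ { _ _ _ e e′ → pair≡ (trans (sym e) e′) })
  (λ { (isP , _) (isP′ , _) _ e e′ → cycles-injective isP isP′ (trans e (sym e′)) })
  (card-perms-countᵇ N good)
  where
  N = 2 * suc i
  good : List ℕ → Bool
  good w = allᵇ (λ c → isOdd (length c)) (cycles w) ∧ (Mperm w ≡ᵇ i)
  Target : List ℕ × List ℕ → Set
  Target x = BalancedPair N x × first (proj₁ x) < first (proj₂ x)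
  pair≡ : ∀ {c d c′ d′ : List ℕ} → c ∷ d ∷ [] ≡ c′ ∷ d′ ∷ [] → (c , d) ≡ (c′ , d′)
  pair≡ refl = refl
  total : ∀ {w} → IsPerm N w × T (good w) → ∃ λ x → Target x × cycles w ≡ proj₁ x ∷ proj₂ x ∷ []
  total {w} (isP , t) with T-∧⁻ {allᵇ (λ c → isOdd (length c)) (cycles w)} t
  ... | odd , M≡ with two-cycles i (cycles w) (All.tabulate (allᵇ⁻ (cycles w) odd)) (≡ᵇ⇒≡ (Mperm w) i M≡)
                        (trans (len (concat-cycles isP)) (2*suc i))
  ... | c , d , eq , bc , bd = (c , d) , ((subst (IsPerm N) (trans (cong concat eq) (cong (c ++_) (++-identityʳ d))) (concat-cycles isP) ,
          minFirstBalanced (proj₂ (cycles-isCycle isP (subst (c ∈_) (sym eq) (here refl)))) bc ,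
          minFirstBalanced (proj₂ (cycles-isCycle isP (subst (d ∈_) (sym eq) (there (here refl))))) bd) ,
          firsts-< isP eq) , eq
  onto : ∀ {x} → Target x → ∃ λ w → (IsPerm N w × T (good w)) × cycles w ≡ proj₁ x ∷ proj₂ x ∷ []
  onto {[] , d} ((_ , g , _) , _) with () ← proj₂ (minFirstBalanced-odd g)
  onto {_ ∷ _ , []} ((_ , _ , g) , _) with () ← proj₂ (minFirstBalanced-odd g)
  onto {c@(_ ∷ _) , d@(_ ∷ _)} ((isP , minFirstBalanced mc bc , minFirstBalanced md bd) , lt) =
    w , (fromCycles-isPerm c d isP , goodw) , eq
    where
    w = fromCycles c d isP
    eq : cycles w ≡ c ∷ d ∷ []
    eq = cycles-fromCycles c d isP refl refl mc md lt
    odd : ∀ {c} → AlmostBalanced (cyclicSteps c) → T (isOdd (length c))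
    odd {c} bal = subst (T ∘ isOdd) (sym (balanced⇒Mcyc-max c bal)) (isOdd-suc-double (Mcyc c))
    regroup : ∀ m n → suc (m + m) + suc (n + n) ≡ suc (suc ((m + (n + 0)) + (m + (n + 0))))
    regroup = solve-∀
    M≡ : Mcyc c + (Mcyc d + 0) ≡ i
    M≡ = double-injective (suc-injective (suc-injective (trans (sym (regroup (Mcyc c) (Mcyc d)))
      (trans (sym (cong₂ _+_ (balanced⇒Mcyc-max c bc) (balanced⇒Mcyc-max d bd)))
        (trans (sym (length-++ c)) (trans (len isP) (2*suc i)))))))
    goodw : T (good w)
    goodw = T-∧⁺ (subst (λ cs → T (allᵇ (λ c → isOdd (length c)) cs)) (sym eq) (T-∧⁺ (odd {c} bc) (T-∧⁺ (odd {d} bd) _)))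
                 (≡⇒≡ᵇ (Mperm w) i (trans (cong (λ cs → sum (map Mcyc cs)) eq) M≡))

-- Swapping the two cycles gives the other half; the minima differ because the letters of the two
-- cycles are disjoint.
card-balancedPairs : ∀ i → Card (BalancedPair (2 * suc i)) (p (2 * suc i) i + p (2 * suc i) i)
card-balancedPairs i = card-⇔ [ proj₁ , proj₁ ]′ cover
  (card-⊎ (λ (_ , lt) (_ , gt) → <-asym lt gt) (card-orderedPairs i) swapped)
  where
  N = 2 * suc i
  swapPair : ∀ {c d} → BalancedPair N (c , d) → BalancedPair N (d , c)
  swapPair {c} {d} (isP , gc , gd) = isPerm-↭ (++-comm c d) isP , gd , gc
  swapped : Card (λ x → BalancedPair N x × first (proj₂ x) < first (proj₁ x)) (p N i)
  swapped = card-bij (λ (c , d) (c′ , d′) → c′ ≡ d × d′ ≡ c)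
    (λ { {c , d} (g , lt) → (d , c) , (swapPair g , lt) , refl , refl })
    (λ { {c , d} (g , lt) → (d , c) , (swapPair g , lt) , refl , refl })
    (λ { _ _ _ (refl , refl) (refl , refl) → refl })
    (λ { _ _ _ (refl , refl) (refl , refl) → refl })
    (card-orderedPairs i)
  cover : ∀ {x} → BalancedPair N x → (BalancedPair N x × first (proj₁ x) < first (proj₂ x)) ⊎ (BalancedPair N x × first (proj₂ x) < first (proj₁ x))
  cover {[] , d} (_ , g , _) with () ← proj₂ (minFirstBalanced-odd g)
  cover {_ ∷ _ , []} (_ , _ , g) with () ← proj₂ (minFirstBalanced-odd g)
  cover {c@(x ∷ xs) , d@(y ∷ ys)} g with <-cmp x y
  ... | tri< lt _ _   = inj₁ (g , lt)
  ... | tri≈ _ refl _ = contradiction (here refl) (disjoint-++ c (distinct (proj₁ g)) (here refl))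
  ... | tri> _ _ gt   = inj₂ (g , gt)

2p≡ECsum : ∀ i → p (2 * suc i) i + p (2 * suc i) i ≡ ECsum (suc i)
2p≡ECsum i = card-unique (card-balancedPairs i)
  (card-pairs (suc i) minFirstBalanced-invariant minFirstBalanced-odd card-minFirstBalanced)

theorem1p8 : (n : ℕ) → 1 ≤ n →
    (b (2 * n) (n Data.Nat.∸ 1) ≡ p (2 * n) (n Data.Nat.∸ 1))
    × (2 * b (2 * n) (n Data.Nat.∸ 1) ≡ ECsum n)
theorem1p8 (suc i) _ =
  double-injective (trans (2b≡ECsum i) (sym (2p≡ECsum i))) ,
  trans (cong (b (2 * suc i) i +_) (+-identityʳ _)) (2b≡ECsum i)
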